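{- Let $c=\frac{1+\sqrt{2}}{2}$ and fix a real number $\varepsilon$ with $0<\varepsilon<c$. There exists an integer $q_0$ (depending on $\varepsilon$) such that for every integer $q\geq q_0$ there exist infinitely many $K_q$-divisible graphs $G$ with minimum degree $\delta(G)\geq \left(1-\frac{1}{(c-\varepsilon)\cdot (q+1)}\right)v(G)$ such that $G$ has no $K_q$-decomposition and even no fractional $K_q$-decomposition.
   Context: Graphs are finite, simple and undirected, and "infinitely many" is understood up to isomorphism. For a graph $G$, $v(G)$ and $e(G)$ denote its numbers of vertices and edges, $d_G(x)$ the degree of a vertex $x$, and $\delta(G)$ the minimum degree. A graph $G$ is $K_q$-divisible if $\binom{q}{2}$ divides $e(G)$ and $q-1$ divides $d_G(x)$ for every vertex $x\in V(G)$. A $K_q$-decomposition of $G$ is a partition of the edge set of $G$ into (edge sets of) edge-disjoint copies of $K_q$ in $G$. A fractional $K_q$-decomposition of $G$ is an assignment of non-negative real weights to the copies of $K_q$ in $G$ such that for every edge $e$ of $G$, the total weight of the copies of $K_q$ containing $e$ is exactly $1$. -}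

module Defs where

open import Level using (0ℓ)
open import Data.Nat.Base as ℕ using (ℕ; zero; suc)
import Data.Nat.Properties as ℕₚ
open import Data.Nat.Combinatorics using (_C_)
open import Data.Nat.Divisibility using (_∣_)
open import Data.Integer.Base as ℤ using (+_)
import Data.Integer.Properties as ℤₚ
open import Data.Rational.Base as ℚ
  using (ℚ; 0ℚ; 1ℚ; ½; _+_; _-_; _*_; -_; ∣_∣; _≤_; _<_; 1/_; positive; nonNegative)
open import Data.Rational.Properties
open import Data.Rational.Solver using (module +-*-Solver)
import Data.Rational.Unnormalised.Base as ℚᵘ
import Data.Rational.Unnormalised.Properties as ℚᵘₚ
open import Data.Fin.Base using (Fin)
import Data.Fin.Properties as Finₚ
open import Data.Fin.Subset using (Subset; inside; outside; _∈_)
  renaming (∣_∣ to card)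
open import Data.Fin.Subset.Properties using (_∈?_)
open import Data.List.Base using (List; []; _∷_; _++_; map; foldr; filter; length; allFin; cartesianProduct)
open import Data.List.Extrema.Nat using (min)
open import Data.Product using (Σ; ∃; ∃!; _×_; _,_; proj₁; proj₂)
open import Data.Sum.Base using (inj₁; inj₂)
import Data.Vec.Base as Vec
open import Function.Base using (_∘_)
open import Function.Bundles using (_↔_; _⇔_; Inverse)
open import Relation.Nullary using (¬_; Dec; yes; no; contradiction)
open import Relation.Nullary.Decidable using (_×-dec_; _→-dec_; ¬?)
open import Relation.Unary using (Pred)
open import Relation.Binary using (Rel; Symmetric; Irreflexive; Decidable; tri<; tri≈; tri>)
open import Relation.Binary.PropositionalEquality

private
  ∣p∣≤q : ∀ {p q} → p ≤ q → - p ≤ q → ∣ p ∣ ≤ q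
  ∣p∣≤q {p} p≤q -p≤q with ∣p∣≡p∨∣p∣≡-p p
  ... | inj₁ eq = subst (_≤ _) (sym eq) p≤q
  ... | inj₂ eq = subst (_≤ _) (sym eq) -p≤q

  p≤∣p∣ : ∀ p → p ≤ ∣ p ∣
  p≤∣p∣ p with ≤-total 0ℚ p
  ... | inj₁ 0≤p = ≤-reflexive (sym (0≤p⇒∣p∣≡p 0≤p))
  ... | inj₂ p≤0 = ≤-trans p≤0 (0≤∣p∣ p)

  *-mono-≤ : ∀ {a b c d} → 0ℚ ≤ a → 0ℚ ≤ d → a ≤ b → c ≤ d → a * c ≤ b * d
  *-mono-≤ {a} {b} {c} {d} 0≤a 0≤d a≤b c≤d = ≤-trans
    (*-monoˡ-≤-nonNeg a {{nonNegative 0≤a}} c≤d)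
    (*-monoʳ-≤-nonNeg d {{nonNegative 0≤d}} a≤b)

  *-pos : ∀ {a b} → 0ℚ < a → 0ℚ < b → 0ℚ < a * b
  *-pos {a} {b} 0<a 0<b =
    positive⁻¹ (a * b) {{pos*pos⇒pos a {{positive 0<a}} b {{positive 0<b}}}}

  *-nonneg : ∀ {a b} → 0ℚ ≤ a → 0ℚ ≤ b → 0ℚ ≤ a * b
  *-nonneg {a} {b} 0≤a 0≤b = subst (_≤ a * b) (*-zeroˡ 0ℚ) (*-mono-≤ ≤-refl 0≤b 0≤a 0≤b)

  +-pos : ∀ {a b} → 0ℚ < a → 0ℚ < b → 0ℚ < a + b
  +-pos {a} {b} 0<a 0<b = subst (_< a + b) (+-identityˡ 0ℚ) (+-mono-< 0<a 0<b)

  ½+½ : ∀ e → ½ * e + ½ * e ≡ e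
  ½+½ e = trans (sym (*-distribʳ-+ e ½ ½)) (*-identityˡ e)

  0<½ : ∀ {e} → 0ℚ < e → 0ℚ < ½ * e
  0<½ = *-pos {½} (positive⁻¹ ½)

-- The reciprocal of a rational, with value 0 at 0.
recipℚ : ℚ → ℚ
recipℚ p with p ≟ 0ℚ
... | yes _  = 0ℚ
... | no p≢0 = (1/ p) {{ℚ.≢-nonZero p≢0}}

p*recip≡1 : ∀ {p} → 0ℚ < p → p * recipℚ p ≡ 1ℚ
p*recip≡1 {p} 0<p with p ≟ 0ℚ
... | yes p≡0 = contradiction 0<p (<-irrefl (sym p≡0))
... | no p≢0  = *-inverseʳ p {{ℚ.≢-nonZero p≢0}}

recip-pos : ∀ {p} → 0ℚ < p → 0ℚ < recipℚ p
recip-pos {p} 0<p = *-cancelˡ-<-nonNeg p {{nonNegative (<⇒≤ 0<p)}}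
  (subst₂ _<_ (sym (*-zeroʳ p)) (sym (p*recip≡1 0<p)) (positive⁻¹ 1ℚ))

ℕ→ℚ : ℕ → ℚ
ℕ→ℚ n = + n ℚ./ 1

unit : ℕ → ℚ
unit n = + 1 ℚ./ suc n

private
  toℚᵘ-/ : ∀ i n → ℚ.toℚᵘ (i ℚ./ suc n) ℚᵘ.≃ ℚᵘ.mkℚᵘ i n
  toℚᵘ-/ i n = toℚᵘ-fromℚᵘ (ℚᵘ.mkℚᵘ i n)

  /-mono-≤ : ∀ i m j n → i ℤ.* + suc n ℤ.≤ j ℤ.* + suc m → i ℚ./ suc m ≤ j ℚ./ suc n
  /-mono-≤ i m j n h = toℚᵘ-cancel-≤
    (ℚᵘₚ.≤-respˡ-≃ (ℚᵘₚ.≃-sym (toℚᵘ-/ i m))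
    (ℚᵘₚ.≤-respʳ-≃ (ℚᵘₚ.≃-sym (toℚᵘ-/ j n)) (ℚᵘ.*≤* h)))

  /-* : ∀ i m j n → (i ℚ./ suc m) * (j ℚ./ suc n) ≡ (i ℤ.* j) ℚ./ (suc m ℕ.* suc n)
  /-* i m j n = toℚᵘ-injective
    (ℚᵘₚ.≃-trans (toℚᵘ-homo-* (i ℚ./ suc m) (j ℚ./ suc n))
    (ℚᵘₚ.≃-trans (ℚᵘₚ.*-cong (toℚᵘ-/ i m) (toℚᵘ-/ j n))
                 (ℚᵘₚ.≃-sym (toℚᵘ-/ (i ℤ.* j) (n ℕ.+ m ℕ.* suc n)))))

ℕ→ℚ-mono : ∀ {m n} → m ℕ.≤ n → ℕ→ℚ m ≤ ℕ→ℚ n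
ℕ→ℚ-mono {m} {n} m≤n = /-mono-≤ (+ m) 0 (+ n) 0
  (ℤₚ.*-monoʳ-≤-nonNeg (+ 1) (ℤ.+≤+ m≤n))

ℕ→ℚ-* : ∀ m n → ℕ→ℚ (m ℕ.* n) ≡ ℕ→ℚ m * ℕ→ℚ n
ℕ→ℚ-* m n = sym (trans (/-* (+ m) 0 (+ n) 0) (cong (ℚ._/ 1) (sym (ℤₚ.pos-* m n))))

ℕ→ℚ-suc : ∀ n → ℕ→ℚ (suc n) ≡ 1ℚ + ℕ→ℚ n
ℕ→ℚ-suc n = toℚᵘ-injective
  (ℚᵘₚ.≃-trans (toℚᵘ-/ (+ suc n) 0)
  (ℚᵘₚ.≃-trans (ℚᵘ.*≡* eq)
  (ℚᵘₚ.≃-sym (ℚᵘₚ.≃-trans (toℚᵘ-homo-+ 1ℚ (ℕ→ℚ n))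
              (ℚᵘₚ.+-cong {ℚ.toℚᵘ 1ℚ} ℚᵘₚ.≃-refl (toℚᵘ-/ (+ n) 0))))))
  where
  eq : + suc n ℤ.* + 1 ≡ (+ 1 ℤ.* + 1 ℤ.+ + n ℤ.* + 1) ℤ.* + 1
  eq = cong (ℤ._* + 1) (cong (λ t → + 1 ℤ.+ t) (sym (ℤₚ.*-identityʳ (+ n))))

unit-anti : ∀ {m n} → m ℕ.≤ n → unit n ≤ unit m
unit-anti {m} {n} m≤n = /-mono-≤ (+ 1) n (+ 1) m
  (ℤₚ.*-monoˡ-≤-nonNeg (+ 1) (ℤ.+≤+ (ℕ.s≤s m≤n)))

0≤unit : ∀ n → 0ℚ ≤ unit n
0≤unit n = nonNegative⁻¹ (unit n) {{normalize-nonNeg 1 (suc n)}}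

suc*unit : ∀ n → ℕ→ℚ (suc n) * unit n ≡ 1ℚ
suc*unit n = trans (/-* (+ suc n) 0 (+ 1) n) (toℚᵘ-injective
  (ℚᵘₚ.≃-trans (toℚᵘ-/ (+ suc n ℤ.* + 1) (n ℕ.+ 0)) (ℚᵘ.*≡* eq)))
  where
  eq : (+ suc n ℤ.* + 1) ℤ.* + 1 ≡ + 1 ℤ.* + suc (n ℕ.+ 0)
  eq = trans (ℤₚ.*-identityʳ _) (trans (ℤₚ.*-identityʳ _)
       (trans (cong (+_ ∘ suc) (sym (ℕₚ.+-identityʳ n))) (sym (ℤₚ.*-identityˡ _))))

archimedean : ∀ {e} → 0ℚ < e → ∃ λ N → unit N ≤ e
archimedean {e@(ℚ.mkℚ (+ suc p) d c)} _ = d , toℚᵘ-cancel-≤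
  (ℚᵘₚ.≤-respˡ-≃ (ℚᵘₚ.≃-sym (toℚᵘ-/ (+ 1) d))
    (ℚᵘ.*≤* (ℤₚ.*-monoʳ-≤-nonNeg (+ suc d) (ℤ.+≤+ (ℕ.s≤s (ℕ.z≤n {p}))))))
archimedean {ℚ.mkℚ (+ zero) d c} (ℚ.*<* (ℤ.+<+ ()))
archimedean {ℚ.mkℚ (ℤ.-[1+ p ]) d c} (ℚ.*<* ())

-- Reals are Cauchy sequences of rationals; their equality is _≃ℝ_, not _≡_.

Eventually : (ℕ → Set) → Set
Eventually P = ∃ λ N → ∀ n → N ℕ.≤ n → P n

Cauchy : (ℕ → ℚ) → Set
Cauchy a = ∀ e → 0ℚ < e → ∃ λ N → ∀ m n → N ℕ.≤ m → N ℕ.≤ n → ∣ a m - a n ∣ ≤ e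

record ℝ : Set where
  constructor real
  field
    seq    : ℕ → ℚ
    cauchy : Cauchy seq

open ℝ public

infix  4 _≃ℝ_ _≤ℝ_ _<ℝ_
infixl 6 _+ℝ_ _-ℝ_
infixl 7 _*ℝ_
infix  8 -ℝ_ _⁻¹⟨_⟩

_≃ℝ_ : ℝ → ℝ → Set
x ≃ℝ y = ∀ e → 0ℚ < e → Eventually λ n → ∣ seq x n - seq y n ∣ ≤ e

_≤ℝ_ : ℝ → ℝ → Set
x ≤ℝ y = ∀ e → 0ℚ < e → Eventually λ n → seq x n ≤ seq y n + e

_<ℝ_ : ℝ → ℝ → Set
x <ℝ y = ∃ λ e → 0ℚ < e × Eventually λ n → seq x n + e ≤ seq y n

private
  merge : ∀ {P Q : ℕ → Set} → Eventually P → Eventually Q → Eventually (λ n → P n × Q n)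
  merge (M , p) (N , q) = M ℕ.⊔ N , λ n h →
    p n (ℕₚ.≤-trans (ℕₚ.m≤m⊔n M N) h) , q n (ℕₚ.≤-trans (ℕₚ.m≤n⊔m M N) h)

fromℚ : ℚ → ℝ
fromℚ p = real (λ _ → p) λ e 0<e → 0 , λ _ _ _ _ →
  ≤-trans (≤-reflexive (cong ∣_∣ (+-inverseʳ p))) (<⇒≤ 0<e)

fromℕ : ℕ → ℝ
fromℕ = fromℚ ∘ ℕ→ℚ

0ℝ 1ℝ : ℝ
0ℝ = fromℚ 0ℚ
1ℝ = fromℚ 1ℚ

_+ℝ_ : ℝ → ℝ → ℝ
x +ℝ y = real (λ n → seq x n + seq y n) proof
  where
  open +-*-Solver
  regroup : ∀ a b c d → (a + b) - (c + d) ≡ (a - c) + (b - d)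
  regroup = solve 4 (λ a b c d → (a :+ b) :- (c :+ d) := (a :- c) :+ (b :- d)) refl

  proof : Cauchy (λ n → seq x n + seq y n)
  proof e 0<e with cauchy x (½ * e) (0<½ 0<e) | cauchy y (½ * e) (0<½ 0<e)
  ... | M , f | N , g = M ℕ.⊔ N , λ m n h k → begin
    ∣ (seq x m + seq y m) - (seq x n + seq y n) ∣
      ≡⟨ cong ∣_∣ (regroup (seq x m) (seq y m) (seq x n) (seq y n)) ⟩
    ∣ (seq x m - seq x n) + (seq y m - seq y n) ∣
      ≤⟨ ∣p+q∣≤∣p∣+∣q∣ (seq x m - seq x n) (seq y m - seq y n) ⟩
    ∣ seq x m - seq x n ∣ + ∣ seq y m - seq y n ∣
      ≤⟨ +-mono-≤ (f m n (ℕₚ.≤-trans (ℕₚ.m≤m⊔n M N) h) (ℕₚ.≤-trans (ℕₚ.m≤m⊔n M N) k))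
                  (g m n (ℕₚ.≤-trans (ℕₚ.m≤n⊔m M N) h) (ℕₚ.≤-trans (ℕₚ.m≤n⊔m M N) k)) ⟩
    ½ * e + ½ * e ≡⟨ ½+½ e ⟩
    e ∎
    where open ≤-Reasoning

-ℝ_ : ℝ → ℝ
-ℝ x = real (λ n → - seq x n) λ e 0<e →
  let N , f = cauchy x e 0<e in N , λ m n h k →
  ≤-trans (≤-reflexive (trans (cong ∣_∣ (sym (neg-distrib-+ (seq x m) (- seq x n))))
                              (∣-p∣≡∣p∣ (seq x m - seq x n))))
          (f m n h k)

_-ℝ_ : ℝ → ℝ → ℝ
x -ℝ y = x +ℝ (-ℝ y)

private
  bounded : ∀ x → ∃ λ B → 0ℚ < B × Eventually λ n → ∣ seq x n ∣ ≤ B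
  bounded x with cauchy x 1ℚ (positive⁻¹ 1ℚ)
  ... | N , f = ∣ seq x N ∣ + 1ℚ
    , subst (_< ∣ seq x N ∣ + 1ℚ) (+-identityˡ 0ℚ)
        (+-mono-≤-< (0≤∣p∣ (seq x N)) (positive⁻¹ 1ℚ))
    , N , λ n h → begin
      ∣ seq x n ∣                        ≡⟨ cong ∣_∣ (split (seq x n) (seq x N)) ⟩
      ∣ seq x N + (seq x n - seq x N) ∣  ≤⟨ ∣p+q∣≤∣p∣+∣q∣ (seq x N) (seq x n - seq x N) ⟩
      ∣ seq x N ∣ + ∣ seq x n - seq x N ∣
        ≤⟨ +-monoʳ-≤ ∣ seq x N ∣ (f n N h ℕₚ.≤-refl) ⟩
      ∣ seq x N ∣ + 1ℚ ∎
    where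
    open ≤-Reasoning
    split : ∀ a b → a ≡ b + (a - b)
    split = solve 2 (λ a b → a := b :+ (a :- b)) refl where open +-*-Solver

_*ℝ_ : ℝ → ℝ → ℝ
x *ℝ y = real (λ n → seq x n * seq y n) proof
  where
  open +-*-Solver
  regroup : ∀ a b c d → a * b - c * d ≡ a * (b - d) + d * (a - c)
  regroup = solve 4 (λ a b c d → a :* b :- c :* d := a :* (b :- d) :+ d :* (a :- c)) refl

  collect : ∀ A B e r → A * (e * r) + B * (e * r) ≡ e * ((A + B) * r)
  collect = solve 4 (λ A B e r → A :* (e :* r) :+ B :* (e :* r) := e :* ((A :+ B) :* r)) refl

  estimate : ∀ {a b c d A B e r} → 0ℚ ≤ e * r → (A + B) * r ≡ 1ℚ →
    ∣ a ∣ ≤ A → ∣ d ∣ ≤ B → ∣ a - c ∣ ≤ e * r → ∣ b - d ∣ ≤ e * r → ∣ a * b - c * d ∣ ≤ e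
  estimate {a} {b} {c} {d} {A} {B} {e} {r} 0≤er unit-r ∣a∣≤A ∣d∣≤B ∣a-c∣≤ ∣b-d∣≤ = begin
    ∣ a * b - c * d ∣                      ≡⟨ cong ∣_∣ (regroup a b c d) ⟩
    ∣ a * (b - d) + d * (a - c) ∣          ≤⟨ ∣p+q∣≤∣p∣+∣q∣ (a * (b - d)) (d * (a - c)) ⟩
    ∣ a * (b - d) ∣ + ∣ d * (a - c) ∣      ≡⟨ cong₂ _+_ (∣p*q∣≡∣p∣*∣q∣ a (b - d)) (∣p*q∣≡∣p∣*∣q∣ d (a - c)) ⟩
    ∣ a ∣ * ∣ b - d ∣ + ∣ d ∣ * ∣ a - c ∣  ≤⟨ +-mono-≤ (*-mono-≤ (0≤∣p∣ a) 0≤er ∣a∣≤A ∣b-d∣≤)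
                                                       (*-mono-≤ (0≤∣p∣ d) 0≤er ∣d∣≤B ∣a-c∣≤) ⟩
    A * (e * r) + B * (e * r)              ≡⟨ collect A B e r ⟩
    e * ((A + B) * r)                      ≡⟨ cong (e *_) unit-r ⟩
    e * 1ℚ                                 ≡⟨ *-identityʳ e ⟩
    e ∎
    where open ≤-Reasoning

  proof : Cauchy (λ n → seq x n * seq y n)
  proof e 0<e =
    let A , 0<A , M , bx = bounded x
        B , 0<B , N , by = bounded y
        0<A+B = +-pos 0<A 0<B
        0<er = *-pos 0<e (recip-pos 0<A+B)
        K , f = cauchy x (e * recipℚ (A + B)) 0<er
        L , g = cauchy y (e * recipℚ (A + B)) 0<er
        toMN : ∀ {n} → (M ℕ.⊔ N) ℕ.⊔ (K ℕ.⊔ L) ℕ.≤ n → M ℕ.⊔ N ℕ.≤ n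
        toMN = ℕₚ.m⊔n≤o⇒m≤o (M ℕ.⊔ N) (K ℕ.⊔ L)
        toKL : ∀ {n} → (M ℕ.⊔ N) ℕ.⊔ (K ℕ.⊔ L) ℕ.≤ n → K ℕ.⊔ L ℕ.≤ n
        toKL = ℕₚ.m⊔n≤o⇒n≤o (M ℕ.⊔ N) (K ℕ.⊔ L)
    in (M ℕ.⊔ N) ℕ.⊔ (K ℕ.⊔ L) , λ m n h k →
    estimate {seq x m} {seq y m} {seq x n} {seq y n} (<⇒≤ 0<er) (p*recip≡1 0<A+B)
      (bx m (ℕₚ.m⊔n≤o⇒m≤o M N (toMN h))) (by n (ℕₚ.m⊔n≤o⇒n≤o M N (toMN k)))
      (f m n (ℕₚ.m⊔n≤o⇒m≤o K L (toKL h)) (ℕₚ.m⊔n≤o⇒m≤o K L (toKL k)))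
      (g m n (ℕₚ.m⊔n≤o⇒n≤o K L (toKL h)) (ℕₚ.m⊔n≤o⇒n≤o K L (toKL k)))

-- Only the Cauchy proof, not the sequence, depends on the positivity witness.
_⁻¹⟨_⟩ : (x : ℝ) → 0ℝ <ℝ x → ℝ
x ⁻¹⟨ a , 0<a , M , pos ⟩ = real (λ n → recipℚ (seq x n)) proof
  where
  open +-*-Solver
  r : ℚ
  r = recipℚ a

  lower : ∀ n → M ℕ.≤ n → a ≤ seq x n
  lower n h = ≤-trans (≤-reflexive (sym (+-identityˡ a))) (pos n h)

  x>0 : ∀ n → M ℕ.≤ n → 0ℚ < seq x n
  x>0 n h = <-≤-trans 0<a (lower n h)

  0≤recip : ∀ n → M ℕ.≤ n → 0ℚ ≤ recipℚ (seq x n)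
  0≤recip n h = <⇒≤ (recip-pos (x>0 n h))

  recip≤r : ∀ n → M ℕ.≤ n → recipℚ (seq x n) ≤ r
  recip≤r n h = begin
    u                    ≡⟨ *-identityʳ u ⟨
    u * 1ℚ               ≡⟨ cong (u *_) (p*recip≡1 0<a) ⟨
    u * (a * r)          ≤⟨ *-monoˡ-≤-nonNeg u {{nonNegative (0≤recip n h)}}
                             (*-monoʳ-≤-nonNeg r {{nonNegative (<⇒≤ (recip-pos 0<a))}} (lower n h)) ⟩
    u * (seq x n * r)    ≡⟨ shuffle u (seq x n) r ⟩
    (seq x n * u) * r    ≡⟨ cong (_* r) (p*recip≡1 (x>0 n h)) ⟩
    1ℚ * r               ≡⟨ *-identityˡ r ⟩
    r ∎
    where
    open ≤-Reasoning
    u : ℚ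
    u = recipℚ (seq x n)
    shuffle : ∀ u s r → u * (s * r) ≡ (s * u) * r
    shuffle = solve 3 (λ u s r → u :* (s :* r) := (s :* u) :* r) refl

  regroup : ∀ s t u v → u * (t * v) - v * (s * u) ≡ (t - s) * (u * v)
  regroup = solve 4 (λ s t u v → u :* (t :* v) :- v :* (s :* u) := (t :- s) :* (u :* v)) refl

  difference : ∀ {s t} → 0ℚ < s → 0ℚ < t →
    recipℚ s - recipℚ t ≡ (t - s) * (recipℚ s * recipℚ t)
  difference {s} {t} 0<s 0<t = trans
    (cong₂ _-_ (sym (trans (cong (recipℚ s *_) (p*recip≡1 0<t)) (*-identityʳ (recipℚ s))))
               (sym (trans (cong (recipℚ t *_) (p*recip≡1 0<s)) (*-identityʳ (recipℚ t)))))
    (regroup s t (recipℚ s) (recipℚ t))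

  collect : ∀ e a r → (e * (a * a)) * (r * r) ≡ e * ((a * r) * (a * r))
  collect = solve 3 (λ e a r → (e :* (a :* a)) :* (r :* r) := e :* ((a :* r) :* (a :* r))) refl

  estimate : ∀ {s t u v e} → 0ℚ ≤ u → 0ℚ ≤ v → u ≤ r → v ≤ r → 0ℚ ≤ r →
    u - v ≡ (t - s) * (u * v) → ∣ t - s ∣ ≤ e * (a * a) → ∣ u - v ∣ ≤ e
  estimate {s} {t} {u} {v} {e} 0≤u 0≤v u≤r v≤r 0≤r eq ∣t-s∣≤ = begin
    ∣ u - v ∣                ≡⟨ cong ∣_∣ eq ⟩
    ∣ (t - s) * (u * v) ∣    ≡⟨ ∣p*q∣≡∣p∣*∣q∣ (t - s) (u * v) ⟩
    ∣ t - s ∣ * ∣ u * v ∣    ≡⟨ cong (∣ t - s ∣ *_) (0≤p⇒∣p∣≡p (*-nonneg 0≤u 0≤v)) ⟩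
    ∣ t - s ∣ * (u * v)      ≤⟨ *-mono-≤ (0≤∣p∣ (t - s)) (*-nonneg 0≤r 0≤r) ∣t-s∣≤
                                  (*-mono-≤ 0≤u 0≤r u≤r v≤r) ⟩
    (e * (a * a)) * (r * r)  ≡⟨ collect e a r ⟩
    e * ((a * r) * (a * r))  ≡⟨ cong (λ z → e * (z * z)) (p*recip≡1 0<a) ⟩
    e * (1ℚ * 1ℚ)            ≡⟨ *-identityʳ e ⟩
    e ∎
    where open ≤-Reasoning

  proof : Cauchy (λ n → recipℚ (seq x n))
  proof e 0<e =
    let N , f = cauchy x (e * (a * a)) (*-pos 0<e (*-pos 0<a 0<a))
    in M ℕ.⊔ N , λ m n h k →
    let hM = ℕₚ.m⊔n≤o⇒m≤o M N h
        kM = ℕₚ.m⊔n≤o⇒m≤o M N k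
    in estimate {seq x m} {seq x n} {recipℚ (seq x m)} {recipℚ (seq x n)} (0≤recip m hM) (0≤recip n kM) (recip≤r m hM) (recip≤r n kM)
         (<⇒≤ (recip-pos 0<a)) (difference (x>0 m hM) (x>0 n kM))
         (f n m (ℕₚ.m⊔n≤o⇒n≤o M N k) (ℕₚ.m⊔n≤o⇒n≤o M N h))

⁻¹-inverse : ∀ x (0<x : 0ℝ <ℝ x) → x *ℝ (x ⁻¹⟨ 0<x ⟩) ≃ℝ 1ℝ
⁻¹-inverse x (a , 0<a , M , pos) e 0<e = M , λ n h →
  ≤-trans (≤-reflexive (cong (λ z → ∣ z - 1ℚ ∣) (p*recip≡1 (<-≤-trans 0<a
    (≤-trans (≤-reflexive (sym (+-identityˡ a))) (pos n h))))))
    (<⇒≤ 0<e)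

<ℝ⇒0<- : ∀ {x y} → x <ℝ y → 0ℝ <ℝ y -ℝ x
<ℝ⇒0<- {x} {y} (e , 0<e , N , f) = e , 0<e , N , λ n h → begin
  0ℚ + e                         ≡⟨ cancel (seq x n) e ⟩
  (seq x n + e) - seq x n        ≤⟨ +-monoˡ-≤ (- seq x n) (f n h) ⟩
  seq y n - seq x n ∎
  where
  open ≤-Reasoning
  cancel : ∀ a e → 0ℚ + e ≡ (a + e) - a
  cancel = solve 2 (λ a e → con 0ℚ :+ e := (a :+ e) :- a) refl where open +-*-Solver

0<*ℝ : ∀ {x y} → 0ℝ <ℝ x → 0ℝ <ℝ y → 0ℝ <ℝ x *ℝ y
0<*ℝ {x} {y} (a , 0<a , f) (b , 0<b , g) = a * b , *-pos 0<a 0<b , K , λ n h → begin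
  0ℚ + a * b         ≡⟨ +-identityˡ (a * b) ⟩
  a * b              ≡⟨ cong₂ _*_ (+-identityˡ a) (+-identityˡ b) ⟨
  (0ℚ + a) * (0ℚ + b)
    ≤⟨ *-mono-≤ (subst (0ℚ ≤_) (sym (+-identityˡ a)) (<⇒≤ 0<a))
         (≤-trans (<⇒≤ (subst (0ℚ <_) (sym (+-identityˡ b)) 0<b)) (proj₂ (k n h)))
         (proj₁ (k n h)) (proj₂ (k n h)) ⟩
  seq x n * seq y n ∎
  where
  open ≤-Reasoning
  both = merge f g
  K = proj₁ both
  k = proj₂ both

0<fromℕ-suc : ∀ n → 0ℝ <ℝ fromℕ (suc n)
0<fromℕ-suc n = 1ℚ , positive⁻¹ 1ℚ , 0 , λ _ _ →
  ≤-trans (≤-reflexive (+-identityˡ 1ℚ)) (ℕ→ℚ-mono {1} {suc n} (ℕ.s≤s ℕ.z≤n))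

isqrt : ℕ → ℕ
isqrt zero = 0
isqrt (suc k) with suc (isqrt k) ℕ.* suc (isqrt k) ℕₚ.≤? suc k
... | yes _ = suc (isqrt k)
... | no _  = isqrt k

isqrt-lower : ∀ k → isqrt k ℕ.* isqrt k ℕ.≤ k
isqrt-lower zero = ℕ.z≤n
isqrt-lower (suc k) with suc (isqrt k) ℕ.* suc (isqrt k) ℕₚ.≤? suc k
... | yes p = p
... | no _  = ℕₚ.m≤n⇒m≤1+n (isqrt-lower k)

isqrt-upper : ∀ k → k ℕ.< suc (isqrt k) ℕ.* suc (isqrt k)
isqrt-upper zero = ℕ.s≤s ℕ.z≤n
isqrt-upper (suc k) with suc (isqrt k) ℕ.* suc (isqrt k) ℕₚ.≤? suc k
... | yes p = ℕₚ.≤-<-trans (isqrt-upper k)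
                (ℕₚ.*-mono-< (ℕₚ.n<1+n (suc (isqrt k))) (ℕₚ.n<1+n (suc (isqrt k))))
... | no ¬p = ℕₚ.≰⇒> ¬p

√-seq : ℕ → ℕ → ℚ
√-seq a n = ℕ→ℚ (isqrt (a ℕ.* (suc n ℕ.* suc n))) * unit n

private
  square-unit : ∀ a n → ℕ→ℚ (a ℕ.* (suc n ℕ.* suc n)) * (unit n * unit n) ≡ ℕ→ℚ a
  square-unit a n = begin
    ℕ→ℚ (a ℕ.* (suc n ℕ.* suc n)) * (u * u)
      ≡⟨ cong (_* (u * u)) (trans (ℕ→ℚ-* a (suc n ℕ.* suc n)) (cong (ℕ→ℚ a *_) (ℕ→ℚ-* (suc n) (suc n)))) ⟩
    (ℕ→ℚ a * (s * s)) * (u * u)   ≡⟨ shuffle (ℕ→ℚ a) s u ⟩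
    ℕ→ℚ a * ((s * u) * (s * u))   ≡⟨ cong (λ z → ℕ→ℚ a * (z * z)) (suc*unit n) ⟩
    ℕ→ℚ a * (1ℚ * 1ℚ)             ≡⟨ *-identityʳ (ℕ→ℚ a) ⟩
    ℕ→ℚ a ∎
    where
    open ≡-Reasoning
    u = unit n
    s = ℕ→ℚ (suc n)
    shuffle : ∀ a s u → (a * (s * s)) * (u * u) ≡ a * ((s * u) * (s * u))
    shuffle = solve 3 (λ a s u → (a :* (s :* s)) :* (u :* u) := a :* ((s :* u) :* (s :* u))) refl
      where open +-*-Solver

  swap² : ∀ s u → (s * u) * (s * u) ≡ (s * s) * (u * u)
  swap² = solve 2 (λ s u → (s :* u) :* (s :* u) := (s :* s) :* (u :* u)) refl
    where open +-*-Solver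

  0≤unit² : ∀ n → 0ℚ ≤ unit n * unit n
  0≤unit² n = *-nonneg (0≤unit n) (0≤unit n)

√-seq-nonneg : ∀ a n → 0ℚ ≤ √-seq a n
√-seq-nonneg a n = *-nonneg
  (ℕ→ℚ-mono {0} {isqrt (a ℕ.* (suc n ℕ.* suc n))} ℕ.z≤n) (0≤unit n)

√-seq-lower : ∀ a n → √-seq a n * √-seq a n ≤ ℕ→ℚ a
√-seq-lower a n = begin
  (s * u) * (s * u)                     ≡⟨ swap² s u ⟩
  (s * s) * (u * u)                     ≡⟨ cong (_* (u * u)) (ℕ→ℚ-* k k) ⟨
  ℕ→ℚ (k ℕ.* k) * (u * u)
    ≤⟨ *-monoʳ-≤-nonNeg (u * u) {{nonNegative (0≤unit² n)}} 
         (ℕ→ℚ-mono {k ℕ.* k} {a ℕ.* (suc n ℕ.* suc n)} (isqrt-lower (a ℕ.* (suc n ℕ.* suc n)))) ⟩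
  ℕ→ℚ (a ℕ.* (suc n ℕ.* suc n)) * (u * u)   ≡⟨ square-unit a n ⟩
  ℕ→ℚ a ∎
  where
  open ≤-Reasoning
  k = isqrt (a ℕ.* (suc n ℕ.* suc n))
  s = ℕ→ℚ k
  u = unit n

√-seq-upper : ∀ a n → ℕ→ℚ a ≤ (√-seq a n + unit n) * (√-seq a n + unit n)
√-seq-upper a n = begin
  ℕ→ℚ a                                     ≡⟨ square-unit a n ⟨
  ℕ→ℚ (a ℕ.* (suc n ℕ.* suc n)) * (u * u)
    ≤⟨ *-monoʳ-≤-nonNeg (u * u) {{nonNegative (0≤unit² n)}}
         (ℕ→ℚ-mono {a ℕ.* (suc n ℕ.* suc n)} {suc k ℕ.* suc k}
           (ℕₚ.<⇒≤ (isqrt-upper (a ℕ.* (suc n ℕ.* suc n))))) ⟩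
  ℕ→ℚ (suc k ℕ.* suc k) * (u * u)  ≡⟨ cong (_* (u * u)) (ℕ→ℚ-* (suc k) (suc k)) ⟩
  (ℕ→ℚ (suc k) * ℕ→ℚ (suc k)) * (u * u)
    ≡⟨ cong (λ z → (z * z) * (u * u)) (ℕ→ℚ-suc k) ⟩
  ((1ℚ + s) * (1ℚ + s)) * (u * u)           ≡⟨ shuffle s u ⟩
  (s * u + u) * (s * u + u) ∎
  where
  open ≤-Reasoning
  k = isqrt (a ℕ.* (suc n ℕ.* suc n))
  s = ℕ→ℚ k
  u = unit n
  shuffle : ∀ s u → ((1ℚ + s) * (1ℚ + s)) * (u * u) ≡ (s * u + u) * (s * u + u)
  shuffle = solve 2 (λ s u → ((con 1ℚ :+ s) :* (con 1ℚ :+ s)) :* (u :* u)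
                           := (s :* u :+ u) :* (s :* u :+ u)) refl
    where open +-*-Solver

private
  square-cancel : ∀ {p q} → 0ℚ ≤ q → p * p ≤ q * q → p ≤ q
  square-cancel {p} {q} 0≤q p²≤q² with <-cmp p q
  ... | tri< p<q _ _ = <⇒≤ p<q
  ... | tri≈ _ p≡q _ = ≤-reflexive p≡q
  ... | tri> _ _ q<p = contradiction (≤-<-trans p²≤q² (begin-strict
    q * q ≤⟨ *-monoˡ-≤-nonNeg q {{nonNegative 0≤q}} (<⇒≤ q<p) ⟩
    q * p <⟨ *-monoˡ-<-pos p {{positive (≤-<-trans 0≤q q<p)}} q<p ⟩
    p * p ∎)) (<-irrefl refl)
    where open ≤-Reasoning

  √-seq-step : ∀ a m n → √-seq a m ≤ √-seq a n + unit n
  √-seq-step a m n = square-cancel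
    (subst (_≤ √-seq a n + unit n) (+-identityˡ 0ℚ) (+-mono-≤ (√-seq-nonneg a n) (0≤unit n)))
    (≤-trans (√-seq-lower a m) (√-seq-upper a n))

  √-seq-diff : ∀ a {N} m n → N ℕ.≤ n → √-seq a m - √-seq a n ≤ unit N
  √-seq-diff a {N} m n h = begin
    √-seq a m - √-seq a n            ≤⟨ +-monoˡ-≤ (- √-seq a n) (√-seq-step a m n) ⟩
    (√-seq a n + unit n) - √-seq a n ≡⟨ cancel (√-seq a n) (unit n) ⟩
    unit n                           ≤⟨ unit-anti {N} {n} h ⟩
    unit N ∎
    where
    open ≤-Reasoning
    cancel : ∀ a e → (a + e) - a ≡ e
    cancel = solve 2 (λ a e → (a :+ e) :- a := e) refl where open +-*-Solver

  neg-diff : ∀ p q → - (p - q) ≡ q - p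
  neg-diff = solve 2 (λ p q → :- (p :- q) := q :- p) refl where open +-*-Solver

infix 9 √_

-- The n-th approximation is ⌊ (n+1)√a ⌋ / (n+1).
√_ : ℕ → ℝ
√ a = real (√-seq a) λ e 0<e → let N , N≤e = archimedean 0<e in N , λ m n h k →
  ≤-trans (∣p∣≤q (√-seq-diff a m n k)
                 (≤-trans (≤-reflexive (neg-diff (√-seq a m) (√-seq a n)))
                          (√-seq-diff a n m h)))
          N≤e

√-nonneg : ∀ a → 0ℝ ≤ℝ √ a
√-nonneg a e 0<e = 0 , λ n _ → subst (_≤ √-seq a n + e) (+-identityˡ 0ℚ)
  (+-mono-≤ (√-seq-nonneg a n) (<⇒≤ 0<e))

√-square : ∀ a → √ a *ℝ √ a ≃ℝ fromℕ a
√-square a e 0<e =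
  let B , 0<B , K , b = bounded (√ a)
      0<C = +-pos 0<B (+-pos 0<B (positive⁻¹ 1ℚ))
      N , N≤ = archimedean (*-pos 0<e (recip-pos 0<C))
  in K ℕ.⊔ N , λ n h → ∣p∣≤q
    (≤-trans (+-monoˡ-≤ (- ℕ→ℚ a) (√-seq-lower a n))
             (≤-trans (≤-reflexive (+-inverseʳ (ℕ→ℚ a))) (<⇒≤ 0<e)))
    (estimate {ℕ→ℚ a} {√-seq a n} {unit n} {B} (0≤unit n) (<⇒≤ 0<C) (p*recip≡1 0<C) (√-seq-upper a n)
      (≤-trans (p≤∣p∣ (√-seq a n)) (b n (ℕₚ.m⊔n≤o⇒m≤o K N h)))
      (≤-trans (unit-anti {N} {n} (ℕₚ.m⊔n≤o⇒n≤o K N h)) N≤)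
      (unit-anti {0} {n} ℕ.z≤n))
  where
  open ≤-Reasoning
  open +-*-Solver
  expand : ∀ s u → (s + u) * (s + u) - s * s ≡ u * (s + (s + u))
  expand = solve 2 (λ s u → (s :+ u) :* (s :+ u) :- s :* s := u :* (s :+ (s :+ u))) refl
  shuffle : ∀ e r C → (e * r) * C ≡ e * (C * r)
  shuffle = solve 3 (λ e r C → (e :* r) :* C := e :* (C :* r)) refl

  estimate : ∀ {p s u B r} → 0ℚ ≤ u → 0ℚ ≤ B + (B + 1ℚ) → (B + (B + 1ℚ)) * r ≡ 1ℚ →
    p ≤ (s + u) * (s + u) → s ≤ B → u ≤ e * r → u ≤ 1ℚ → - (s * s - p) ≤ e
  estimate {p} {s} {u} {B} {r} 0≤u 0≤C unit-r p≤ s≤B u≤ u≤1 = begin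
    - (s * s - p)                 ≡⟨ neg-diff (s * s) p ⟩
    p - s * s                     ≤⟨ +-monoˡ-≤ (- (s * s)) p≤ ⟩
    (s + u) * (s + u) - s * s     ≡⟨ expand s u ⟩
    u * (s + (s + u))             ≤⟨ *-mono-≤ 0≤u 0≤C u≤ (+-mono-≤ s≤B (+-mono-≤ s≤B u≤1)) ⟩
    (e * r) * (B + (B + 1ℚ))      ≡⟨ shuffle e r (B + (B + 1ℚ)) ⟩
    e * ((B + (B + 1ℚ)) * r)      ≡⟨ cong (e *_) unit-r ⟩
    e * 1ℚ                        ≡⟨ *-identityʳ e ⟩
    e ∎

c : ℝ
c = (1ℝ +ℝ √ 2) *ℝ fromℚ ½

record Graph : Set₁ where
  field
    v      : ℕ
    Adj    : Rel (Fin v) 0ℓ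
    adj?   : Decidable Adj
    symm   : Symmetric Adj
    irrefl : Irreflexive _≡_ Adj

open Graph public using (v; Adj; adj?)

infix 4 _≅_

_≅_ : Graph → Graph → Set
G ≅ H = Σ (Fin (v G) ↔ Fin (v H)) λ f →
  ∀ x y → Adj G x y ⇔ Adj H (Inverse.to f x) (Inverse.to f y)

-- Up to isomorphism.
InfinitelyMany : (Graph → Set₁) → Set₁
InfinitelyMany P = Σ (ℕ → Graph) λ G →
  (∀ i → P (G i)) × (∀ {i j} → i ≢ j → ¬ (G i ≅ G j))

e : Graph → ℕ
e G = length (filter (λ (x , y) → (x Finₚ.<? y) ×-dec adj? G x y)
                     (cartesianProduct (allFin (v G)) (allFin (v G))))

d : (G : Graph) → Fin (v G) → ℕ
d G x = length (filter (adj? G x) (allFin (v G)))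

-- Every degree is less than v G, so the default value v G of the minimum
-- only matters for the graph without vertices.
δ : Graph → ℕ
δ G = min (v G) (map (d G) (allFin (v G)))

record Divisible (q : ℕ) (G : Graph) : Set where
  field
    edges   : q C 2 ∣ e G
    degrees : ∀ x → q ℕ.∸ 1 ∣ d G x

-- A copy of K_q in G is determined by its vertex set.
IsCopy : (q : ℕ) (G : Graph) → Subset (v G) → Set
IsCopy q G S = card S ≡ q × (∀ x y → x ∈ S → y ∈ S → x ≢ y → Adj G x y)

isCopy? : ∀ q G (S : Subset (v G)) → Dec (IsCopy q G S)
isCopy? q G S = (card S ℕₚ.≟ q) ×-dec
  Finₚ.all? λ x → Finₚ.all? λ y →
    (x ∈? S) →-dec ((y ∈? S) →-dec (¬? (x Finₚ.≟ y) →-dec adj? G x y))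

record Decomposition (q : ℕ) (G : Graph) : Set₁ where
  field
    Part    : Pred (Subset (v G)) 0ℓ
    isCopy  : ∀ {S} → Part S → IsCopy q G S
    covered : ∀ x y → Adj G x y → ∃! _≡_ λ S → Part S × x ∈ S × y ∈ S

subsets : ∀ n → List (Subset n)
subsets zero    = Vec.[] ∷ []
subsets (suc n) = map (outside Vec.∷_) (subsets n) ++ map (inside Vec.∷_) (subsets n)

copiesContaining : (q : ℕ) (G : Graph) → Fin (v G) → Fin (v G) → List (Subset (v G))
copiesContaining q G x y =
  filter (λ S → isCopy? q G S ×-dec ((x ∈? S) ×-dec (y ∈? S))) (subsets (v G))

sumℝ : List ℝ → ℝ
sumℝ = foldr _+ℝ_ 0ℝ

-- The values of the weight on sets that are not copies of K_q are irrelevant.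
FractionalDecomposition : (q : ℕ) (G : Graph) → Set
FractionalDecomposition q G = Σ (Subset (v G) → ℝ) λ weight →
  (∀ S → IsCopy q G S → 0ℝ ≤ℝ weight S) ×
  (∀ x y → Adj G x y → sumℝ (map weight (copiesContaining q G x y)) ≃ℝ 1ℝ)

{-# OPTIONS --safe #-}

-- The vertex set is split into s ≈ q/√2 equal parts; distinct parts are completely joined, and every
-- part carries a D-regular bipartite graph.  If a K_q has a_i vertices in the i-th part, then
-- Σ (a_i − 1)(a_i − 2) ≥ 0 shows that at least q − s of its edges lie inside parts.  Hence a fractional
-- decomposition needs at least the proportion (q − s) / C(q,2) of all edges to lie inside parts, and D is
-- chosen just below this threshold.  With σ = s/q, every vertex then has about
-- (1 − 2σ + 2σ²) / (σ q) · v(G) non-neighbours; σ / (1 − 2σ + 2σ²) is largest at σ = 1/√2, with value c.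
module Submission where

open import Defs
open import Algebra.Bundles using (CommutativeRing)
open import Data.Bool.Base using (true; false; if_then_else_)
open import Data.Fin.Base using (Fin; zero; suc; toℕ; combine; remQuot; _↑ˡ_; _↑ʳ_) renaming (_<_ to _<ᶠ_)
open import Data.Fin.Permutation using (↔⇒≡)
import Data.Fin.Properties as Fin
open import Data.Fin.Subset using (Subset; inside; outside; _∈_) renaming (∣_∣ to card)
open import Data.Fin.Subset.Properties using (_∈?_)
open import Data.List.Base using (List; []; _∷_; _++_; map; filter; length; foldr; allFin; cartesianProduct; tabulate)
open import Data.List.Extrema.Nat using (v≤min⁺)
import Data.List.Properties as List
import Data.List.Relation.Unary.All as All
import Data.List.Relation.Unary.All.Properties as All
open import Data.Nat.Base as ℕ using (ℕ; zero; suc; z≤n; s≤s; NonZero; >-nonZero; >-nonZero⁻¹)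
open import Data.Nat.Combinatorics using (_C_; nC1≡n; nCk+nC[k+1]≡[n+1]C[k+1])
open import Data.Nat.Divisibility using (_∣_; divides; ∣-trans; ∣m∣n⇒∣m+n; n∣m*n; ∣n⇒∣m*n; ∣m⇒∣m*n)
open import Data.Nat.DivMod using (_%_; _/_; [m+n]%n≡m%n; m<n⇒m%n≡m; m/n*n≤m; m≡m%n+[m/n]*n; m%n<n)
import Data.Nat.Properties as ℕ
open import Data.Nat.Tactic.RingSolver using (solve-∀)
open import Data.Product.Base using (∃; _×_; _,_; proj₁; proj₂)
open import Data.Rational.Base using (ℚ; 0ℚ; 1ℚ; ½; ∣_∣; positive; nonNegative)
import Data.Rational.Properties as ℚ
open import Data.Rational.Solver using (module +-*-Solver)
open import Data.Sum.Base using (_⊎_; inj₁; inj₂)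
open import Data.Vec.Base using ([]; _∷_)
open import Function.Base using (_∘_)
open import Relation.Binary using (tri<; tri≈; tri>)
open import Relation.Binary.PropositionalEquality
open import Relation.Nullary using (¬_; Dec; does; yes; no; contradiction)
open import Relation.Nullary.Decidable using (_×-dec_; _⊎-dec_; ¬?; ¬¬-excluded-middle; dec-true; dec-false)
open import Relation.Unary using (Decidable)
open import Algebra.Properties.Semiring.Sum ℕ.+-*-semiring
  using (sum; sum-syntax; sum-cong-≗; ∑-distrib-+; ∑-comm; *-distribˡ-sum; *-distribʳ-sum)
open import Algebra.Properties.Semiring.Sum (CommutativeRing.semiring ℚ.+-*-commutativeRing) as ℚ∑
  using () renaming (sum to sumℚ)

-- The polynomial (a - 1)(a - 2) fits because a part meets a copy in q/s ≈ √2 vertices on average,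
-- between 1 and 2; equality holds when every a_i is 1 or 2.
--
-- The counting bound is used as a dual certificate: with weight 2(q - s) on all edges and q(q - 1)
-- on inner edges, no copy favours the first weighting, but the whole graph does. Both totals are
-- natural numbers, so they differ by at least 1. This gap is what lets the argument work with real
-- weights given only as Cauchy sequences: at one late index the weights are merely almost
-- nonnegative and the edge sums almost 1, and a total error below 1 is enough.
--
-- All rounding (s = ⌊q/√2⌋, q² in place of q(q - 1) in the choice of `D`, the q + 1 of the
-- statement) costs O(q²) in an inequality between terms of order q³; the condition ε(q + 1) ≥ 38
-- pays for it. Scaling the part size and `D` by a common multiple of q - 1 yields divisibility and
-- infinitely many orders without changing any ratio.

module Counting where

  open import Data.Nat.Base using (_+_; _*_; _≤_)

  -- Indicators and finite sums

  ⟦_⟧ : ∀ {a} {A : Set a} → Dec A → ℕ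
  ⟦ a? ⟧ = if does a? then 1 else 0

  ⟦⟧-yes : ∀ {a} {A : Set a} (a? : Dec A) → A → ⟦ a? ⟧ ≡ 1
  ⟦⟧-yes a? a rewrite dec-true a? a = refl

  ⟦⟧-no : ∀ {a} {A : Set a} (a? : Dec A) → ¬ A → ⟦ a? ⟧ ≡ 0
  ⟦⟧-no a? ¬a rewrite dec-false a? ¬a = refl

  ⟦⟧-cong : ∀ {a b} {A : Set a} {B : Set b} (a? : Dec A) (b? : Dec B) → (A → B) → (B → A) → ⟦ a? ⟧ ≡ ⟦ b? ⟧
  ⟦⟧-cong a? (yes b) _   B⇒A = ⟦⟧-yes a? (B⇒A b)
  ⟦⟧-cong a? (no ¬b) A⇒B _   = ⟦⟧-no a? (¬b ∘ A⇒B)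

  ⟦⟧-idem : ∀ {a} {A : Set a} (a? : Dec A) → ⟦ a? ⟧ * ⟦ a? ⟧ ≡ ⟦ a? ⟧
  ⟦⟧-idem a? with does a?
  ... | true  = refl
  ... | false = refl

  ⟦⟧-× : ∀ {a b} {A : Set a} {B : Set b} (a? : Dec A) (b? : Dec B) → ⟦ a? ×-dec b? ⟧ ≡ ⟦ a? ⟧ * ⟦ b? ⟧
  ⟦⟧-× a? b? with does a? | does b?
  ... | true  | true  = refl
  ... | true  | false = refl
  ... | false | _     = refl

  ⟦⟧-disjoint : ∀ {a b} {A : Set a} {B : Set b} (a? : Dec A) (b? : Dec B) → (A → ¬ B) → ⟦ a? ⟧ * ⟦ b? ⟧ ≡ 0
  ⟦⟧-disjoint (no _)  _       _        = refl
  ⟦⟧-disjoint (yes _) (no _)  _        = refl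
  ⟦⟧-disjoint (yes a) (yes b) disjoint = contradiction b (disjoint a)

  ∑-cong₂ : ∀ {m n} {f g : Fin m → Fin n → ℕ} → (∀ x y → f x y ≡ g x y) →
    ∑[ x < m ] ∑[ y < n ] f x y ≡ ∑[ x < m ] ∑[ y < n ] g x y
  ∑-cong₂ f≗g = sum-cong-≗ (λ x → sum-cong-≗ (f≗g x))

  ∑-distrib-+₂ : ∀ {m n} (f g : Fin m → Fin n → ℕ) →
    ∑[ x < m ] ∑[ y < n ] (f x y + g x y) ≡ ∑[ x < m ] ∑[ y < n ] f x y + ∑[ x < m ] ∑[ y < n ] g x y
  ∑-distrib-+₂ f g = trans (sum-cong-≗ (λ x → ∑-distrib-+ (f x) (g x)))
                           (∑-distrib-+ (λ x → sum (f x)) (λ x → sum (g x)))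

  *-distribˡ-∑₂ : ∀ {m n} k (f : Fin m → Fin n → ℕ) →
    k * ∑[ x < m ] ∑[ y < n ] f x y ≡ ∑[ x < m ] ∑[ y < n ] (k * f x y)
  *-distribˡ-∑₂ k f = trans (*-distribˡ-sum k (λ x → sum (f x))) (sum-cong-≗ (λ x → *-distribˡ-sum k (f x)))

  ∑-mono : ∀ {n} {f g : Fin n → ℕ} → (∀ i → f i ≤ g i) → sum f ≤ sum g
  ∑-mono {zero}  f≤g = z≤n
  ∑-mono {suc n} f≤g = ℕ.+-mono-≤ (f≤g zero) (∑-mono (f≤g ∘ suc))

  ∑-const : ∀ n k → ∑[ i < n ] k ≡ n * k
  ∑-const zero    k = refl
  ∑-const (suc n) k = cong (k +_) (∑-const n k)

  ∑-const′ : ∀ {n k} {f : Fin n → ℕ} → (∀ i → f i ≡ k) → sum f ≡ n * k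
  ∑-const′ {n} {k} f≗k = trans (sum-cong-≗ f≗k) (∑-const n k)

  ∑-product : ∀ {m n} (f : Fin m → ℕ) (g : Fin n → ℕ) → ∑[ x < m ] ∑[ y < n ] (f x * g y) ≡ sum f * sum g
  ∑-product f g = trans (sum-cong-≗ (λ x → sym (*-distribˡ-sum (f x) g))) (sym (*-distribʳ-sum (sum g) f))

  ⟦suc≟suc⟧ : ∀ {n} (i j : Fin n) → ⟦ suc i Fin.≟ suc j ⟧ ≡ ⟦ i Fin.≟ j ⟧
  ⟦suc≟suc⟧ i j with i Fin.≟ j
  ... | yes _ = refl
  ... | no _  = refl

  ∑-delta : ∀ {n} (f : Fin n → ℕ) j → ∑[ i < n ] (⟦ i Fin.≟ j ⟧ * f i) ≡ f j
  ∑-delta {suc n} f zero = trans (cong₂ _+_ (ℕ.*-identityˡ (f zero)) (trans (∑-const n 0) (ℕ.*-zeroʳ n))) (ℕ.+-identityʳ (f zero))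
  ∑-delta {suc n} f (suc j) = trans (sum-cong-≗ (λ i → cong (_* f (suc i)) (⟦suc≟suc⟧ i j))) (∑-delta (f ∘ suc) j)

  ∑-++ : ∀ m {n} (f : Fin (m + n) → ℕ) → sum f ≡ ∑[ i < m ] f (i ↑ˡ n) + ∑[ j < n ] f (m ↑ʳ j)
  ∑-++ zero    f = refl
  ∑-++ (suc m) f = trans (cong (f zero +_) (∑-++ m (f ∘ suc))) (sym (ℕ.+-assoc (f zero) _ _))

  ∑-combine : ∀ m {n} (f : Fin (m * n) → ℕ) → sum f ≡ ∑[ i < m ] ∑[ j < n ] f (combine i j)
  ∑-combine zero        f = refl
  ∑-combine (suc m) {n} f = trans (∑-++ n f) (cong (sum (λ j → f (j ↑ˡ (m * n))) +_) (∑-combine m (f ∘ (n ↑ʳ_))))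

  module _ {A : Set} {P : A → Set} (P? : Decidable P) where

    length-filter-∷ : ∀ x xs → length (filter P? (x ∷ xs)) ≡ ⟦ P? x ⟧ + length (filter P? xs)
    length-filter-∷ x xs with does (P? x)
    ... | true  = refl
    ... | false = refl

    length-filter-tabulate : ∀ {n} (f : Fin n → A) → length (filter P? (tabulate f)) ≡ ∑[ i < n ] ⟦ P? (f i) ⟧
    length-filter-tabulate {zero}  f = refl
    length-filter-tabulate {suc n} f =
      trans (length-filter-∷ (f zero) (tabulate (f ∘ suc))) (cong (⟦ P? (f zero) ⟧ +_) (length-filter-tabulate (f ∘ suc)))

  length-filter-cartesianProduct : ∀ {m n} {P : Fin m × Fin n → Set} (P? : Decidable P) →
    length (filter P? (cartesianProduct (allFin m) (allFin n))) ≡ ∑[ x < m ] ∑[ y < n ] ⟦ P? (x , y) ⟧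
  length-filter-cartesianProduct {m} {n} P? = rows (λ x → x)
    where
    rows : ∀ {k} (g : Fin k → Fin m) →
      length (filter P? (cartesianProduct (tabulate g) (allFin n))) ≡ ∑[ x < k ] ∑[ y < n ] ⟦ P? (g x , y) ⟧
    rows {zero}  g = refl
    rows {suc k} g = begin
      length (filter P? (row ++ rest))                   ≡⟨ cong length (List.filter-++ P? row rest) ⟩
      length (filter P? row ++ filter P? rest)           ≡⟨ List.length-++ (filter P? row) ⟩
      length (filter P? row) + length (filter P? rest)
        ≡⟨ cong₂ _+_ (trans (cong (length ∘ filter P?) (List.map-tabulate (λ y → y) (g zero ,_)))
                            (length-filter-tabulate P? (g zero ,_)))
                     (rows (g ∘ suc)) ⟩
      ∑[ x < suc k ] ∑[ y < n ] ⟦ P? (g x , y) ⟧ ∎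
      where
      open ≡-Reasoning
      row = map (g zero ,_) (allFin n)
      rest = cartesianProduct (tabulate (g ∘ suc)) (allFin n)

  card≡∑ : ∀ {n} (S : Subset n) → card S ≡ ∑[ x < n ] ⟦ x ∈? S ⟧
  card≡∑ []            = refl
  card≡∑ (inside ∷ S)  = cong suc (card≡∑ S)
  card≡∑ (outside ∷ S) = card≡∑ S

  -- Ordered pairs of vertices in a graph and in a clique

  module _ (G : Graph) where

    open Graph G using (symm; irrefl)

    d≡∑ : ∀ x → d G x ≡ ∑[ y < v G ] ⟦ adj? G x y ⟧
    d≡∑ x = length-filter-tabulate (adj? G x) (λ y → y)

    -- `e` counts adjacent pairs with x before y. Adding the same count with the roles exchanged
    -- meets every ordered adjacent pair once, by trichotomy and symmetry.
    handshake : 2 * e G ≡ ∑[ x < v G ] d G x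
    handshake = begin
      2 * e G          ≡⟨ cong (λ z → e G + z) (ℕ.+-identityʳ (e G)) ⟩
      e G + e G        ≡⟨ cong₂ _+_ e≡ (trans e≡ (∑-comm (λ x y → ⟦ lt x y ⟧))) ⟩
      ∑[ x < v G ] ∑[ y < v G ] ⟦ lt x y ⟧ + ∑[ x < v G ] ∑[ y < v G ] ⟦ lt y x ⟧
        ≡⟨ ∑-distrib-+₂ (λ x y → ⟦ lt x y ⟧) (λ x y → ⟦ lt y x ⟧) ⟨
      ∑[ x < v G ] ∑[ y < v G ] (⟦ lt x y ⟧ + ⟦ lt y x ⟧)   ≡⟨ ∑-cong₂ split ⟩
      ∑[ x < v G ] ∑[ y < v G ] ⟦ adj? G x y ⟧              ≡⟨ sum-cong-≗ (λ x → sym (d≡∑ x)) ⟩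
      ∑[ x < v G ] d G x ∎
      where
      open ≡-Reasoning
      lt : ∀ x y → Dec (x <ᶠ y × Adj G x y)
      lt x y = (x Fin.<? y) ×-dec adj? G x y

      e≡ : e G ≡ ∑[ x < v G ] ∑[ y < v G ] ⟦ lt x y ⟧
      e≡ = length-filter-cartesianProduct (λ (x , y) → lt x y)

      split : ∀ x y → ⟦ lt x y ⟧ + ⟦ lt y x ⟧ ≡ ⟦ adj? G x y ⟧
      split x y with adj? G x y
      ... | no ¬a = cong₂ _+_ (⟦⟧-no ((x Fin.<? y) ×-dec no ¬a) (¬a ∘ proj₂)) (⟦⟧-no (lt y x) (¬a ∘ symm ∘ proj₂))
      ... | yes a with Fin.<-cmp x y
      ...   | tri< x<y _ y≮x = cong₂ _+_ (⟦⟧-yes ((x Fin.<? y) ×-dec yes a) (x<y , a)) (⟦⟧-no (lt y x) (y≮x ∘ proj₁))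
      ...   | tri≈ _ x≡y _ = contradiction a (irrefl x≡y)
      ...   | tri> x≮y _ y<x = cong₂ _+_ (⟦⟧-no ((x Fin.<? y) ×-dec yes a) (x≮y ∘ proj₁)) (⟦⟧-yes (lt y x) (y<x , symm a))

    within : Subset (v G) → (Fin (v G) → Fin (v G) → ℕ) → ℕ
    within S h = ∑[ x < v G ] ∑[ y < v G ] (⟦ x ∈? S ⟧ * ⟦ y ∈? S ⟧ * h x y)

    -- `within` sums over ordered pairs, the diagonal included. On a clique the adjacency factor
    -- removes exactly the diagonal, where `h` is 1 at each of the q vertices.
    within-copy : ∀ {q S} → IsCopy q G S → (h : Fin (v G) → Fin (v G) → ℕ) → (∀ x → h x x ≡ 1) →
      within S (λ x y → ⟦ adj? G x y ⟧ * h x y) + q ≡ within S h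
    within-copy {q} {S} (cardS , clique) h h-diag = begin
      within S (λ x y → ⟦ adj? G x y ⟧ * h x y) + q
        ≡⟨ cong (within S _ +_) (trans (sym cardS) (trans (card≡∑ S) (sum-cong-≗ (λ x → sym (∑-delta (λ _ → ⟦ x ∈? S ⟧) x))))) ⟩
      within S (λ x y → ⟦ adj? G x y ⟧ * h x y) + ∑[ x < v G ] ∑[ y < v G ] (⟦ y Fin.≟ x ⟧ * ⟦ x ∈? S ⟧)
        ≡⟨ ∑-distrib-+₂ _ (λ x y → ⟦ y Fin.≟ x ⟧ * ⟦ x ∈? S ⟧) ⟨
      ∑[ x < v G ] ∑[ y < v G ] (⟦ x ∈? S ⟧ * ⟦ y ∈? S ⟧ * (⟦ adj? G x y ⟧ * h x y) + ⟦ y Fin.≟ x ⟧ * ⟦ x ∈? S ⟧)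
        ≡⟨ ∑-cong₂ pair ⟩
      within S h ∎
      where
      open ≡-Reasoning
      pair : ∀ x y → ⟦ x ∈? S ⟧ * ⟦ y ∈? S ⟧ * (⟦ adj? G x y ⟧ * h x y) + ⟦ y Fin.≟ x ⟧ * ⟦ x ∈? S ⟧
        ≡ ⟦ x ∈? S ⟧ * ⟦ y ∈? S ⟧ * h x y
      pair x y with y Fin.≟ x
      ... | yes refl rewrite ⟦⟧-no (adj? G x x) (irrefl refl) | h-diag x | ⟦⟧-idem (x ∈? S) =
        trans (cong (_+ (⟦ x ∈? S ⟧ + 0)) (ℕ.*-zeroʳ ⟦ x ∈? S ⟧)) (trans (ℕ.+-identityʳ _) (sym (ℕ.*-identityʳ _)))
      ... | no y≢x with x ∈? S | y ∈? S
      ...   | no _ | _ = refl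
      ...   | yes _ | no _ = refl
      ...   | yes x∈S | yes y∈S rewrite ⟦⟧-yes (adj? G x y) (clique x y x∈S y∈S (y≢x ∘ sym)) =
        trans (ℕ.+-identityʳ _) (cong (_+ 0) (ℕ.*-identityˡ (h x y)))

    within-adj : ∀ {q S} → IsCopy q G S → within S (λ x y → ⟦ adj? G x y ⟧) + q ≡ q * q
    within-adj {q} {S} copy@(cardS , _) = begin
      within S (λ x y → ⟦ adj? G x y ⟧) + q
        ≡⟨ cong (_+ q) (∑-cong₂ (λ x y → cong (⟦ x ∈? S ⟧ * ⟦ y ∈? S ⟧ *_) (sym (ℕ.*-identityʳ _)))) ⟩
      within S (λ x y → ⟦ adj? G x y ⟧ * 1) + q       ≡⟨ within-copy copy (λ _ _ → 1) (λ _ → refl) ⟩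
      within S (λ _ _ → 1)                           ≡⟨ ∑-cong₂ {v G} {v G} (λ x y → ℕ.*-identityʳ (⟦ x ∈? S ⟧ * ⟦ y ∈? S ⟧)) ⟩
      ∑[ x < v G ] ∑[ y < v G ] (⟦ x ∈? S ⟧ * ⟦ y ∈? S ⟧)  ≡⟨ ∑-product (λ x → ⟦ x ∈? S ⟧) (λ y → ⟦ y ∈? S ⟧) ⟩
      sum (λ x → ⟦ x ∈? S ⟧) * sum (λ x → ⟦ x ∈? S ⟧)
        ≡⟨ cong (λ m → m * m) (trans (sym (card≡∑ S)) cardS) ⟩
      q * q ∎
      where open ≡-Reasoning

    module _ {s} (π : Fin (v G) → Fin s) where

      same : Fin (v G) → Fin (v G) → ℕ
      same x y = ⟦ π x Fin.≟ π y ⟧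

      inner : Fin (v G) → Fin (v G) → ℕ
      inner x y = ⟦ adj? G x y ⟧ * same x y

      -- Σ a_i² counts the ordered pairs of `S` in a common part: q diagonal ones and the inner
      -- edges. Summing 3 a_i ≤ a_i² + 2 over the parts, with Σ a_i = q, gives the bound. The
      -- additive form avoids truncated subtraction.
      within-inner : ∀ {q S} → IsCopy q G S → 2 * q ≤ within S inner + 2 * s
      within-inner {q} {S} copy@(cardS , _) = ℕ.+-cancelʳ-≤ q _ _ (begin
        2 * q + q                              ≡⟨ three q ⟩
        3 * q                                  ≡⟨ cong (3 *_) (sym ∑a) ⟩
        3 * ∑[ i < s ] a i                     ≡⟨ *-distribˡ-sum 3 a ⟩
        ∑[ i < s ] (3 * a i)                   ≤⟨ ∑-mono (λ i → quadratic (a i)) ⟩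
        ∑[ i < s ] (a i * a i + 2)             ≡⟨ ∑-distrib-+ (λ i → a i * a i) (λ _ → 2) ⟩
        ∑[ i < s ] (a i * a i) + ∑[ i < s ] 2  ≡⟨ cong₂ _+_ ∑a² (∑-const s 2) ⟩
        within S same + s * 2                  ≡⟨ cong (_+ s * 2) (within-copy copy same (λ x → ⟦⟧-yes (π x Fin.≟ π x) refl)) ⟨
        within S inner + q + s * 2             ≡⟨ regroup (within S inner) q s ⟩
        within S inner + 2 * s + q             ∎)
        where
        open ℕ.≤-Reasoning
        three : ∀ q → 2 * q + q ≡ 3 * q
        three = solve-∀
        regroup : ∀ w q s → w + q + s * 2 ≡ w + 2 * s + q
        regroup = solve-∀

        a : Fin s → ℕ
        a i = ∑[ x < v G ] (⟦ i Fin.≟ π x ⟧ * ⟦ x ∈? S ⟧)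

        -- (a - 1)(a - 2) ≥ 0 for every integer a.
        quadratic : ∀ a → 3 * a ≤ a * a + 2
        quadratic 0 = z≤n
        quadratic 1 = ℕ.≤-refl
        quadratic (suc (suc b)) = subst (3 * (2 + b) ≤_) (sym (expand b)) (ℕ.m≤m+n _ _)
          where
          expand : ∀ b → (2 + b) * (2 + b) + 2 ≡ 3 * (2 + b) + (b * b + b)
          expand = solve-∀

        ∑a : ∑[ i < s ] a i ≡ q
        ∑a = trans (∑-comm (λ i x → ⟦ i Fin.≟ π x ⟧ * ⟦ x ∈? S ⟧))
            (trans (sum-cong-≗ (λ x → ∑-delta (λ _ → ⟦ x ∈? S ⟧) (π x)))
            (trans (sym (card≡∑ S)) cardS))

        ∑a² : ∑[ i < s ] (a i * a i) ≡ within S same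
        ∑a² = begin-equality
          ∑[ i < s ] (a i * a i) ≡⟨ sum-cong-≗ (λ i → sym (∑-product (t i) (t i))) ⟩
          ∑[ i < s ] ∑[ x < v G ] ∑[ y < v G ] (t i x * t i y) ≡⟨ ∑-comm (λ i x → ∑[ y < v G ] (t i x * t i y)) ⟩
          ∑[ x < v G ] ∑[ i < s ] ∑[ y < v G ] (t i x * t i y) ≡⟨ sum-cong-≗ (λ x → ∑-comm (λ i y → t i x * t i y)) ⟩
          ∑[ x < v G ] ∑[ y < v G ] ∑[ i < s ] (t i x * t i y)
            -- For a fixed pair only i = `π x` survives, and the other indicator then says that y
            -- lies in that same part.
            ≡⟨ ∑-cong₂ (λ x y → trans (sum-cong-≗ (λ i → swap ⟦ i Fin.≟ π x ⟧ ⟦ x ∈? S ⟧ ⟦ i Fin.≟ π y ⟧ ⟦ y ∈? S ⟧))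
                          (∑-delta (λ i → ⟦ x ∈? S ⟧ * ⟦ y ∈? S ⟧ * ⟦ i Fin.≟ π y ⟧) (π x))) ⟩
          within S same ∎
          where
          t : Fin s → Fin (v G) → ℕ
          t i x = ⟦ i Fin.≟ π x ⟧ * ⟦ x ∈? S ⟧
          swap : ∀ a b c d → (a * b) * (c * d) ≡ a * (b * d * c)
          swap = solve-∀

open Counting

-- Weak duality for fractional decompositions with Cauchy real weights

module Duality where

  open import Data.Rational.Base using (_+_; _-_; _*_; -_; _≤_; _<_)
  open +-*-Solver using (solve; con; _:+_; _:*_; _:-_; :-_; _:=_)

  *-monoˡ : ∀ {p q r} → 0ℚ ≤ r → p ≤ q → r * p ≤ r * q
  *-monoˡ {r = r} 0≤r = ℚ.*-monoˡ-≤-nonNeg r {{nonNegative 0≤r}}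

  *-monoʳ : ∀ {p q r} → 0ℚ ≤ r → p ≤ q → p * r ≤ q * r
  *-monoʳ {r = r} 0≤r = ℚ.*-monoʳ-≤-nonNeg r {{nonNegative 0≤r}}

  ∣p∣≤q⇒p≤q : ∀ {p q} → ∣ p ∣ ≤ q → p ≤ q
  ∣p∣≤q⇒p≤q {p} h with ℚ.≤-total 0ℚ p
  ... | inj₁ 0≤p = ℚ.≤-trans (ℚ.≤-reflexive (sym (ℚ.0≤p⇒∣p∣≡p 0≤p))) h
  ... | inj₂ p≤0 = ℚ.≤-trans p≤0 (ℚ.≤-trans (ℚ.0≤∣p∣ p) h)

  ∣p∣≤q⇒-p≤q : ∀ {p q} → ∣ p ∣ ≤ q → - p ≤ q
  ∣p∣≤q⇒-p≤q {p} {q} h = ∣p∣≤q⇒p≤q (subst (_≤ q) (sym (ℚ.∣-p∣≡∣p∣ p)) h)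

  0≤ℕ→ℚ : ∀ n → 0ℚ ≤ ℕ→ℚ n
  0≤ℕ→ℚ n = ℕ→ℚ-mono {0} {n} ℕ.z≤n

  ℕ→ℚ-+ : ∀ m n → ℕ→ℚ (m ℕ.+ n) ≡ ℕ→ℚ m + ℕ→ℚ n
  ℕ→ℚ-+ zero    n = sym (ℚ.+-identityˡ (ℕ→ℚ n))
  ℕ→ℚ-+ (suc m) n = begin
    ℕ→ℚ (suc (m ℕ.+ n))     ≡⟨ ℕ→ℚ-suc (m ℕ.+ n) ⟩
    1ℚ + ℕ→ℚ (m ℕ.+ n)      ≡⟨ cong (1ℚ +_) (ℕ→ℚ-+ m n) ⟩
    1ℚ + (ℕ→ℚ m + ℕ→ℚ n)    ≡⟨ ℚ.+-assoc 1ℚ (ℕ→ℚ m) (ℕ→ℚ n) ⟨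
    (1ℚ + ℕ→ℚ m) + ℕ→ℚ n    ≡⟨ cong (_+ ℕ→ℚ n) (ℕ→ℚ-suc m) ⟨
    ℕ→ℚ (suc m) + ℕ→ℚ n ∎
    where open ≡-Reasoning

  ℕ→ℚ-∑ : ∀ {n} (f : Fin n → ℕ) → ℕ→ℚ (sum f) ≡ sumℚ (ℕ→ℚ ∘ f)
  ℕ→ℚ-∑ {zero}  f = refl
  ℕ→ℚ-∑ {suc n} f = trans (ℕ→ℚ-+ (f zero) (sum (f ∘ suc))) (cong (ℕ→ℚ (f zero) +_) (ℕ→ℚ-∑ (f ∘ suc)))

  sumℚ-mono : ∀ {n} {f g : Fin n → ℚ} → (∀ i → f i ≤ g i) → sumℚ f ≤ sumℚ g
  sumℚ-mono {zero}  f≤g = ℚ.≤-refl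
  sumℚ-mono {suc n} f≤g = ℚ.+-mono-≤ (f≤g zero) (sumℚ-mono (f≤g ∘ suc))

  ℕ→ℚ-∑₂-* : ∀ {m n} (h : Fin m → Fin n → ℕ) r →
    sumℚ (λ x → sumℚ (λ y → ℕ→ℚ (h x y) * r)) ≡ ℕ→ℚ (∑[ x < m ] ∑[ y < n ] h x y) * r
  ℕ→ℚ-∑₂-* h r = begin
    sumℚ (λ x → sumℚ (λ y → ℕ→ℚ (h x y) * r))
      ≡⟨ ℚ∑.sum-cong-≗ (λ x → sym (trans (cong (_* r) (ℕ→ℚ-∑ (h x))) (ℚ∑.*-distribʳ-sum r (ℕ→ℚ ∘ h x)))) ⟩
    sumℚ (λ x → ℕ→ℚ (sum (h x)) * r)     ≡⟨ ℚ∑.*-distribʳ-sum r (λ x → ℕ→ℚ (sum (h x))) ⟨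
    sumℚ (λ x → ℕ→ℚ (sum (h x))) * r     ≡⟨ cong (_* r) (ℕ→ℚ-∑ (λ x → sum (h x))) ⟨
    ℕ→ℚ (sum (λ x → sum (h x))) * r ∎
    where open ≡-Reasoning

  +-nonneg : ∀ {p q} → 0ℚ ≤ p → 0ℚ ≤ q → 0ℚ ≤ p + q
  +-nonneg {p} {q} 0≤p 0≤q = subst (_≤ p + q) (ℚ.+-identityˡ 0ℚ) (ℚ.+-mono-≤ 0≤p 0≤q)

  -- Bounds on loads are known only for edges; elsewhere the edge weighting vanishes and both sides
  -- are 0.
  scaled-mono : ∀ {A : Set} {n p q} → Dec A → (A → p ≤ q) → (¬ A → n ≡ 0) → ℕ→ℚ n * p ≤ ℕ→ℚ n * q
  scaled-mono {n = n} (yes a) p≤q _ = *-monoˡ (0≤ℕ→ℚ n) (p≤q a)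
  scaled-mono {n = n} {p} {q} (no ¬a) _ n≡0 = subst (λ m → ℕ→ℚ m * p ≤ ℕ→ℚ m * q) (sym (n≡0 ¬a))
    (ℚ.≤-reflexive (trans (ℚ.*-zeroˡ p) (sym (ℚ.*-zeroˡ q))))

  module _ {A : Set} where

    listSum : (A → ℚ) → List A → ℚ
    listSum f = foldr (λ a r → f a + r) 0ℚ

    listSum-cong : ∀ {f g : A → ℚ} → (∀ a → f a ≡ g a) → ∀ L → listSum f L ≡ listSum g L
    listSum-cong f≗g []      = refl
    listSum-cong f≗g (a ∷ L) = cong₂ _+_ (f≗g a) (listSum-cong f≗g L)

    listSum-mono : ∀ {f g : A → ℚ} → (∀ a → f a ≤ g a) → ∀ L → listSum f L ≤ listSum g L
    listSum-mono f≤g []      = ℚ.≤-refl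
    listSum-mono f≤g (a ∷ L) = ℚ.+-mono-≤ (f≤g a) (listSum-mono f≤g L)

    listSum-0 : ∀ {f : A → ℚ} → (∀ a → f a ≡ 0ℚ) → ∀ L → listSum f L ≡ 0ℚ
    listSum-0 f≗0 []      = refl
    listSum-0 f≗0 (a ∷ L) = cong₂ _+_ (f≗0 a) (listSum-0 f≗0 L)

    listSum-++ : ∀ (f : A → ℚ) K L → listSum f (K ++ L) ≡ listSum f K + listSum f L
    listSum-++ f []      L = sym (ℚ.+-identityˡ _)
    listSum-++ f (a ∷ K) L = trans (cong (f a +_) (listSum-++ f K L)) (sym (ℚ.+-assoc (f a) (listSum f K) (listSum f L)))

    listSum-map : ∀ {B : Set} (f : A → ℚ) (g : B → A) L → listSum f (map g L) ≡ foldr (λ b r → f (g b) + r) 0ℚ L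
    listSum-map f g []      = refl
    listSum-map f g (b ∷ L) = cong (f (g b) +_) (listSum-map f g L)

    listSum-shift : ∀ (f : A → ℚ) r L → listSum (λ a → f a + r) L ≡ listSum f L + r * ℕ→ℚ (length L)
    listSum-shift f r []      = sym (trans (cong (0ℚ +_) (ℚ.*-zeroʳ r)) (ℚ.+-identityˡ 0ℚ))
    listSum-shift f r (a ∷ L) rewrite ℕ→ℚ-suc (length L) | listSum-shift f r L = regroup (f a) r (listSum f L) (ℕ→ℚ (length L))
      where
      regroup : ∀ p r s l → (p + r) + (s + r * l) ≡ (p + s) + r * (1ℚ + l)
      regroup = solve 4 (λ p r s l → (p :+ r) :+ (s :+ r :* l) := (p :+ s) :+ r :* (con 1ℚ :+ l)) refl

    listSum-*ˡ : ∀ r (f : A → ℚ) L → r * listSum f L ≡ listSum (λ a → r * f a) L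
    listSum-*ˡ r f []      = ℚ.*-zeroʳ r
    listSum-*ˡ r f (a ∷ L) = trans (ℚ.*-distribˡ-+ r (f a) (listSum f L)) (cong (r * f a +_) (listSum-*ˡ r f L))

    listSum-filter : ∀ {P : A → Set} (P? : Decidable P) (f : A → ℚ) L →
      listSum f (filter P? L) ≡ listSum (λ a → ℕ→ℚ ⟦ P? a ⟧ * f a) L
    listSum-filter P? f []      = refl
    listSum-filter P? f (a ∷ L) with does (P? a)
    ... | true  = cong₂ _+_ (sym (ℚ.*-identityˡ (f a))) (listSum-filter P? f L)
    ... | false = trans (listSum-filter P? f L)
      (sym (trans (cong (_+ _) (ℚ.*-zeroˡ (f a))) (ℚ.+-identityˡ _)))

    sumℚ-listSum : ∀ {n} (f : Fin n → A → ℚ) L →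
      sumℚ (λ x → listSum (f x) L) ≡ listSum (λ a → sumℚ (λ x → f x a)) L
    sumℚ-listSum {n} f []      = ℚ∑.sum-replicate-zero n
    sumℚ-listSum {n} f (a ∷ L) = trans (ℚ∑.∑-distrib-+ (λ x → f x a) (λ x → listSum (f x) L))
      (cong (sumℚ (λ x → f x a) +_) (sumℚ-listSum f L))

    seq-sumℝ : ∀ (w : A → ℝ) L k → seq (sumℝ (map w L)) k ≡ listSum (λ a → seq (w a) k) L
    seq-sumℝ w []      k = refl
    seq-sumℝ w (a ∷ L) k = cong (seq (w a) k +_) (seq-sumℝ w L k)

  Eventually-× : ∀ {P Q : ℕ → Set} → Eventually P → Eventually Q → Eventually (λ k → P k × Q k)
  Eventually-× (M , p) (N , q) = M ℕ.⊔ N , λ k h → p k (ℕ.m⊔n≤o⇒m≤o M N h) , q k (ℕ.m⊔n≤o⇒n≤o M N h)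

  Eventually-map : ∀ {P Q : ℕ → Set} → (∀ {k} → P k → Q k) → Eventually P → Eventually Q
  Eventually-map P⇒Q (N , p) = N , λ k h → P⇒Q (p k h)

  -- The index has to be fixed before a proof of `A` is at hand, so `A` must be decided. It will be
  -- adjacency or being a copy.
  Eventually-→ : ∀ {A : Set} {P : ℕ → Set} → Dec A → (A → Eventually P) → Eventually (λ k → A → P k)
  Eventually-→ (yes a) h = Eventually-map (λ p _ → p) (h a)
  Eventually-→ (no ¬a) h = 0 , λ _ _ a → contradiction a ¬a

  Eventually-Fin : ∀ {n} {P : Fin n → ℕ → Set} → (∀ x → Eventually (P x)) → Eventually (λ k → ∀ x → P x k)
  Eventually-Fin {zero}  h = 0 , λ _ _ ()
  Eventually-Fin {suc n} h = Eventually-map (λ { (p , ps) zero → p ; (p , ps) (suc x) → ps x })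
    (Eventually-× (h zero) (Eventually-Fin (h ∘ suc)))

  Eventually-Subset : ∀ {n} {P : Subset n → ℕ → Set} → (∀ S → Eventually (P S)) → Eventually (λ k → ∀ S → P S k)
  Eventually-Subset {zero}  h = Eventually-map (λ { p [] → p }) (h [])
  Eventually-Subset {suc n} h = Eventually-map (λ { (p , q) (outside ∷ S) → p S ; (p , q) (inside ∷ S) → q S })
    (Eventually-× (Eventually-Subset (h ∘ (outside ∷_))) (Eventually-Subset (h ∘ (inside ∷_))))

  -- Double negation passes through a universal quantifier over finitely many cases; recursion on
  -- the first bit joins the two halves.
  ¬¬-Subset : ∀ {n} {P : Subset n → Set} → (∀ S → ¬ ¬ P S) → ¬ ¬ (∀ S → P S)
  ¬¬-Subset {zero}  h k = h [] (λ p → k (λ { [] → p }))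
  ¬¬-Subset {suc n} h k = ¬¬-Subset (h ∘ (outside ∷_)) (λ p → ¬¬-Subset (h ∘ (inside ∷_)) (λ q →
    k (λ { (outside ∷ S) → p S ; (inside ∷ S) → q S })))

  -- Here it matters that `subsets n` lists every subset exactly once: of the two halves given by
  -- the first bit, one sums to 1 by recursion and the other to 0.
  listSum-subsets-delta : ∀ {n} (f : Subset n → ℚ) S → f S ≡ 1ℚ → (∀ {U} → U ≢ S → f U ≡ 0ℚ) →
    listSum f (subsets n) ≡ 1ℚ
  listSum-subsets-delta {zero} f [] fS _ = trans (cong (_+ 0ℚ) fS) (ℚ.+-identityʳ 1ℚ)
  listSum-subsets-delta {suc n} f (b ∷ S) fS f≢S = trans
    (trans (listSum-++ f (map (outside ∷_) (subsets n)) (map (inside ∷_) (subsets n)))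
           (cong₂ _+_ (listSum-map f (outside ∷_) (subsets n)) (listSum-map f (inside ∷_) (subsets n))))
    (halves b fS f≢S)
    where
    half : ∀ b → f (b ∷ S) ≡ 1ℚ → (∀ {U} → U ≢ b ∷ S → f U ≡ 0ℚ) → listSum (f ∘ (b ∷_)) (subsets n) ≡ 1ℚ
    half b fS f≢S = listSum-subsets-delta (f ∘ (b ∷_)) S fS (λ U≢S → f≢S (λ { refl → U≢S refl }))

    halves : ∀ b → f (b ∷ S) ≡ 1ℚ → (∀ {U} → U ≢ b ∷ S → f U ≡ 0ℚ) →
      listSum (f ∘ (outside ∷_)) (subsets n) + listSum (f ∘ (inside ∷_)) (subsets n) ≡ 1ℚ
    halves outside fS f≢S = trans
      (cong₂ _+_ (half outside fS f≢S) (listSum-0 (λ U → f≢S {inside ∷ U} (λ ())) (subsets n))) (ℚ.+-identityʳ 1ℚ)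
    halves inside  fS f≢S = trans
      (cong₂ _+_ (listSum-0 (λ U → f≢S {outside ∷ U} (λ ())) (subsets n)) (half inside fS f≢S)) (ℚ.+-identityˡ 1ℚ)

  module _ (q : ℕ) (G : Graph) where

    -- Part need not be decidable, so a decomposition yields a fractional one only up to double negation.
    fractional-of-decidable : (D : Decomposition q G) → (∀ S → Dec (Decomposition.Part D S)) → FractionalDecomposition q G
    fractional-of-decidable D part? = weight , nonneg , total
      where
      open Decomposition D
      weight : Subset (v G) → ℝ
      weight S = fromℕ ⟦ part? S ⟧

      nonneg : ∀ S → IsCopy q G S → 0ℝ ≤ℝ weight S
      nonneg S _ ε 0<ε = 0 , λ _ _ → +-nonneg (0≤ℕ→ℚ ⟦ part? S ⟧) (ℚ.<⇒≤ 0<ε)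

      module _ {x y} (x~y : Adj G x y) where
        S = proj₁ (covered x y x~y)
        S∈ = proj₁ (proj₁ (proj₂ (covered x y x~y)))
        x,y∈S = proj₂ (proj₁ (proj₂ (covered x y x~y)))
        unique = proj₂ (proj₂ (covered x y x~y))

        contains? : ∀ U → Dec (IsCopy q G U × x ∈ U × y ∈ U)
        contains? U = isCopy? q G U ×-dec ((x ∈? U) ×-dec (y ∈? U))

        at-S : ℕ→ℚ ⟦ contains? S ⟧ * ℕ→ℚ ⟦ part? S ⟧ ≡ 1ℚ
        at-S = cong₂ (λ a b → ℕ→ℚ a * ℕ→ℚ b) (⟦⟧-yes (contains? S) (isCopy S∈ , x,y∈S)) (⟦⟧-yes (part? S) S∈)

        off-S : ∀ {U} → U ≢ S → ℕ→ℚ ⟦ contains? U ⟧ * ℕ→ℚ ⟦ part? U ⟧ ≡ 0ℚ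
        off-S {U} U≢S = trans (sym (ℕ→ℚ-* ⟦ contains? U ⟧ ⟦ part? U ⟧)) (cong ℕ→ℚ
          (⟦⟧-disjoint (contains? U) (part? U) (λ (_ , x,y∈U) U∈ → U≢S (sym (unique (U∈ , x,y∈U))))))

        listSum≡1 : listSum (λ U → ℕ→ℚ ⟦ part? U ⟧) (copiesContaining q G x y) ≡ 1ℚ
        listSum≡1 = trans (listSum-filter contains? (λ U → ℕ→ℚ ⟦ part? U ⟧) (subsets (v G)))
          (listSum-subsets-delta (λ U → ℕ→ℚ ⟦ contains? U ⟧ * ℕ→ℚ ⟦ part? U ⟧) S at-S off-S)

      total : ∀ x y → Adj G x y → sumℝ (map weight (copiesContaining q G x y)) ≃ℝ 1ℝ
      total x y x~y ε 0<ε = 0 , λ k _ → subst (λ z → ∣ z - 1ℚ ∣ ≤ ε)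
        (sym (trans (seq-sumℝ weight (copiesContaining q G x y) k) (listSum≡1 x~y))) (ℚ.<⇒≤ 0<ε)

    decomposition⇒¬¬fractional : Decomposition q G → ¬ ¬ FractionalDecomposition q G
    decomposition⇒¬¬fractional D ¬frac =
      ¬¬-Subset (λ S → ¬¬-excluded-middle) (λ part? → ¬frac (fractional-of-decidable D part?))

    -- The conditions on the weights are finitely many eventual statements, one per copy and one per
    -- ordered edge, hence they hold together at some index. From there on only rational numbers
    -- occur.
    approximate : ((w , _) : FractionalDecomposition q G) → ∀ {η} → 0ℚ < η → ∃ λ k →
      (∀ S → IsCopy q G S → 0ℚ ≤ seq (w S) k + η) ×
      (∀ x y → Adj G x y → ∣ listSum (λ S → seq (w S) k) (copiesContaining q G x y) - 1ℚ ∣ ≤ η)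
    approximate (w , nonneg , total) {η} 0<η = proj₁ both , proj₂ both (proj₁ both) ℕ.≤-refl
      where
      both = Eventually-×
        (Eventually-Subset (λ S → Eventually-→ (isCopy? q G S) (λ copy → nonneg S copy η 0<η)))
        (Eventually-Fin (λ x → Eventually-Fin (λ y → Eventually-→ (adj? G x y) (λ x~y →
          Eventually-map (λ {k} → subst (λ z → ∣ z - 1ℚ ∣ ≤ η) (seq-sumℝ w (copiesContaining q G x y) k))
            (total x y x~y η 0<η)))))

    -- Weak LP duality: the edge weighting g - f is nonnegative on every copy but negative in total.
    module _ (f g : Fin (v G) → Fin (v G) → ℕ)
      (f-supp : ∀ {x y} → ¬ Adj G x y → f x y ≡ 0) (g-supp : ∀ {x y} → ¬ Adj G x y → g x y ≡ 0)
      (f≤g : ∀ {S} → IsCopy q G S → within G S f ℕ.≤ within G S g)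
      where

      private
        n = v G
        ∑∑ : (Fin n → Fin n → ℕ) → ℕ
        ∑∑ h = ∑[ x < n ] ∑[ y < n ] h x y

      module _ (u : Subset n → ℚ) (0≤u : ∀ S → IsCopy q G S → 0ℚ ≤ u S) where

        load : Fin n → Fin n → ℚ
        load x y = listSum u (copiesContaining q G x y)

        weighted : (Fin n → Fin n → ℕ) → ℚ
        weighted h = sumℚ (λ x → sumℚ (λ y → ℕ→ℚ (h x y) * load x y))

        -- Double counting: the weight of the copies through each pair, summed over pairs, is the
        -- `h`-value of the pairs inside each copy, summed over copies.
        weighted≡ : ∀ h → weighted h ≡ listSum (λ S → ℕ→ℚ (⟦ isCopy? q G S ⟧ ℕ.* within G S h) * u S) (subsets n)
        weighted≡ h = begin
          weighted h
            ≡⟨ ℚ∑.sum-cong-≗ (λ x → ℚ∑.sum-cong-≗ (λ y → trans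
                 (cong (ℕ→ℚ (h x y) *_) (listSum-filter (λ S → isCopy? q G S ×-dec ((x ∈? S) ×-dec (y ∈? S))) u (subsets n)))
                 (trans (listSum-*ˡ (ℕ→ℚ (h x y)) _ (subsets n)) (listSum-cong (term x y) (subsets n))))) ⟩
          sumℚ (λ x → sumℚ (λ y → listSum (λ S → ℕ→ℚ (k S x y) * u S) (subsets n)))
            ≡⟨ ℚ∑.sum-cong-≗ (λ x → sumℚ-listSum (λ y S → ℕ→ℚ (k S x y) * u S) (subsets n)) ⟩
          sumℚ (λ x → listSum (λ S → sumℚ (λ y → ℕ→ℚ (k S x y) * u S)) (subsets n))
            ≡⟨ sumℚ-listSum (λ x S → sumℚ (λ y → ℕ→ℚ (k S x y) * u S)) (subsets n) ⟩
          listSum (λ S → sumℚ (λ x → sumℚ (λ y → ℕ→ℚ (k S x y) * u S))) (subsets n)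
            ≡⟨ listSum-cong (λ S → trans (ℕ→ℚ-∑₂-* (k S) (u S))
                 (cong (λ z → ℕ→ℚ z * u S) (sym (*-distribˡ-∑₂ ⟦ isCopy? q G S ⟧
                   (λ x y → ⟦ x ∈? S ⟧ ℕ.* ⟦ y ∈? S ⟧ ℕ.* h x y))))) (subsets n) ⟩
          listSum (λ S → ℕ→ℚ (⟦ isCopy? q G S ⟧ ℕ.* within G S h) * u S) (subsets n) ∎
          where
          open ≡-Reasoning
          k : Subset n → Fin n → Fin n → ℕ
          k S x y = ⟦ isCopy? q G S ⟧ ℕ.* (⟦ x ∈? S ⟧ ℕ.* ⟦ y ∈? S ⟧ ℕ.* h x y)
          term : ∀ x y S → ℕ→ℚ (h x y) * (ℕ→ℚ ⟦ isCopy? q G S ×-dec ((x ∈? S) ×-dec (y ∈? S)) ⟧ * u S) ≡ ℕ→ℚ (k S x y) * u S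
          term x y S = begin
            ℕ→ℚ (h x y) * (ℕ→ℚ ⟦ isCopy? q G S ×-dec ((x ∈? S) ×-dec (y ∈? S)) ⟧ * u S)
              ≡⟨ ℚ.*-assoc (ℕ→ℚ (h x y)) _ (u S) ⟨
            ℕ→ℚ (h x y) * ℕ→ℚ ⟦ isCopy? q G S ×-dec ((x ∈? S) ×-dec (y ∈? S)) ⟧ * u S
              ≡⟨ cong (_* u S) (ℕ→ℚ-* (h x y) _) ⟨
            ℕ→ℚ (h x y ℕ.* ⟦ isCopy? q G S ×-dec ((x ∈? S) ×-dec (y ∈? S)) ⟧) * u S
              ≡⟨ cong (λ z → ℕ→ℚ z * u S) (trans (ℕ.*-comm (h x y) _) (trans
                   (cong (ℕ._* h x y) (trans (⟦⟧-× (isCopy? q G S) ((x ∈? S) ×-dec (y ∈? S)))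
                      (cong (⟦ isCopy? q G S ⟧ ℕ.*_) (⟦⟧-× (x ∈? S) (y ∈? S)))))
                   (ℕ.*-assoc ⟦ isCopy? q G S ⟧ _ (h x y)))) ⟩
            ℕ→ℚ (k S x y) * u S ∎

        weighted-mono : weighted f ≤ weighted g
        weighted-mono = subst₂ _≤_ (sym (weighted≡ f)) (sym (weighted≡ g)) (listSum-mono term (subsets n))
          where
          term : ∀ S → ℕ→ℚ (⟦ isCopy? q G S ⟧ ℕ.* within G S f) * u S ≤ ℕ→ℚ (⟦ isCopy? q G S ⟧ ℕ.* within G S g) * u S
          term S = by-cases (isCopy? q G S)
            where
            by-cases : (c : Dec (IsCopy q G S)) → ℕ→ℚ (⟦ c ⟧ ℕ.* within G S f) * u S ≤ ℕ→ℚ (⟦ c ⟧ ℕ.* within G S g) * u S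
            by-cases (no _)     = ℚ.≤-refl
            by-cases (yes copy) = *-monoʳ (0≤u S copy)
              (ℕ→ℚ-mono {1 ℕ.* within G S f} {1 ℕ.* within G S g} (ℕ.*-monoʳ-≤ 1 (f≤g copy)))

        weighted-lower : ∀ {r} → (∀ {x y} → Adj G x y → r ≤ load x y) → ℕ→ℚ (∑∑ f) * r ≤ weighted f
        weighted-lower {r} r≤ = subst (_≤ weighted f) (ℕ→ℚ-∑₂-* f r) (sumℚ-mono (λ x → sumℚ-mono (term x)))
          where
          term : ∀ x y → ℕ→ℚ (f x y) * r ≤ ℕ→ℚ (f x y) * load x y
          term x y = scaled-mono (adj? G x y) r≤ f-supp

        weighted-upper : ∀ {r} → (∀ {x y} → Adj G x y → load x y ≤ r) → weighted g ≤ ℕ→ℚ (∑∑ g) * r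
        weighted-upper {r} ≤r = subst (weighted g ≤_) (ℕ→ℚ-∑₂-* g r) (sumℚ-mono (λ x → sumℚ-mono (term x)))
          where
          term : ∀ x y → ℕ→ℚ (g x y) * load x y ≤ ℕ→ℚ (g x y) * r
          term x y = scaled-mono (adj? G x y) ≤r g-supp

      -- With exact weights, exchanging the sums would give Σ f ≤ Σ g. Approximate weights weaken
      -- this by at most η (Σ f + (1 + m) Σ g), with m the number of subsets. Both totals being
      -- natural numbers, an error below 1 still contradicts Σ g < Σ f.
      no-fractional : ∑∑ g ℕ.< ∑∑ f → ¬ FractionalDecomposition q G
      no-fractional g<f frac@(w , _) = ℚ.<-irrefl refl (begin-strict
        1ℚ + Γ                                 ≡⟨ ℕ→ℚ-suc (∑∑ g) ⟨
        ℕ→ℚ (suc (∑∑ g))                       ≤⟨ ℕ→ℚ-mono {suc (∑∑ g)} {∑∑ f} g<f ⟩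
        Φ                                      ≡⟨ split Φ η ⟩
        Φ * (1ℚ - η) + η * Φ                   ≤⟨ ℚ.+-monoˡ-≤ (η * Φ) (weighted-lower u 0≤u lower) ⟩
        weighted u 0≤u f + η * Φ               ≤⟨ ℚ.+-monoˡ-≤ (η * Φ) (weighted-mono u 0≤u) ⟩
        weighted u 0≤u g + η * Φ               ≤⟨ ℚ.+-monoˡ-≤ (η * Φ) (weighted-upper u 0≤u upper) ⟩
        Γ * ((1ℚ + η) + η * M) + η * Φ         ≡⟨ collect Γ η M Φ ⟩
        η * (Φ + (1ℚ + M) * Γ) + Γ             ≡⟨ cong (λ z → η * z + Γ) K≡ ⟨
        η * ℕ→ℚ K + Γ                          <⟨ ℚ.+-monoˡ-< Γ η*K<1 ⟩
        1ℚ + Γ ∎)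
        where
        open ℚ.≤-Reasoning
        m = length (subsets n)
        -- With η = 1 / (K + 1) the error η K stays strictly below 1.
        K = ∑∑ f ℕ.+ suc m ℕ.* ∑∑ g
        η = unit K
        Φ = ℕ→ℚ (∑∑ f)
        Γ = ℕ→ℚ (∑∑ g)
        M = ℕ→ℚ m

        0<η : 0ℚ < η
        0<η = ℚ.positive⁻¹ η {{ℚ.normalize-pos 1 (suc K)}}

        K≡ : ℕ→ℚ K ≡ Φ + (1ℚ + M) * Γ
        K≡ = trans (ℕ→ℚ-+ (∑∑ f) (suc m ℕ.* ∑∑ g)) (cong (Φ +_) (trans (ℕ→ℚ-* (suc m) (∑∑ g)) (cong (_* Γ) (ℕ→ℚ-suc m))))

        η*K<1 : η * ℕ→ℚ K < 1ℚ
        η*K<1 = begin-strict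
          η * ℕ→ℚ K            ≡⟨ ℚ.+-identityˡ (η * ℕ→ℚ K) ⟨
          0ℚ + η * ℕ→ℚ K       <⟨ ℚ.+-monoˡ-< (η * ℕ→ℚ K) 0<η ⟩
          η + η * ℕ→ℚ K        ≡⟨ factor η (ℕ→ℚ K) ⟩
          (1ℚ + ℕ→ℚ K) * η     ≡⟨ cong (_* η) (ℕ→ℚ-suc K) ⟨
          ℕ→ℚ (suc K) * η      ≡⟨ suc*unit K ⟩
          1ℚ ∎
          where
          factor : ∀ η k → η + η * k ≡ (1ℚ + k) * η
          factor = solve 2 (λ η k → η :+ η :* k := (con 1ℚ :+ k) :* η) refl

        split : ∀ Φ η → Φ ≡ Φ * (1ℚ - η) + η * Φ
        split = solve 2 (λ Φ η → Φ := Φ :* (con 1ℚ :- η) :+ η :* Φ) refl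
        collect : ∀ Γ η M Φ → Γ * ((1ℚ + η) + η * M) + η * Φ ≡ η * (Φ + (1ℚ + M) * Γ) + Γ
        collect = solve 4 (λ Γ η M Φ → Γ :* ((con 1ℚ :+ η) :+ η :* M) :+ η :* Φ := η :* (Φ :+ (con 1ℚ :+ M) :* Γ) :+ Γ) refl

        approx = approximate frac 0<η
        k = proj₁ approx

        -- The shift by η makes the almost nonnegative weights nonnegative, as monotonicity over the
        -- copies demands. A load grows by at most η m, since at most m copies contain an edge.
        u : Subset n → ℚ
        u S = seq (w S) k + η

        0≤u : ∀ S → IsCopy q G S → 0ℚ ≤ u S
        0≤u = proj₁ (proj₂ approx)

        module _ {x y} (x~y : Adj G x y) where
          L = copiesContaining q G x y
          z = listSum (λ S → seq (w S) k) L

          load≡ : load u 0≤u x y ≡ z + η * ℕ→ℚ (length L)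
          load≡ = listSum-shift (λ S → seq (w S) k) η L

          ∣z-1∣≤η : ∣ z - 1ℚ ∣ ≤ η
          ∣z-1∣≤η = proj₂ (proj₂ approx) x y x~y

          lower : 1ℚ - η ≤ load u 0≤u x y
          lower = begin
            1ℚ - η                        ≤⟨ ℚ.+-monoʳ-≤ 1ℚ (ℚ.neg-antimono-≤ (∣p∣≤q⇒-p≤q {z - 1ℚ} ∣z-1∣≤η)) ⟩
            1ℚ - (- (z - 1ℚ))             ≡⟨ cancel z ⟩
            z + 0ℚ                        ≡⟨ cong (z +_) (ℚ.*-zeroʳ η) ⟨
            z + η * 0ℚ                    ≤⟨ ℚ.+-monoʳ-≤ z (*-monoˡ (ℚ.<⇒≤ 0<η) (0≤ℕ→ℚ (length L))) ⟩
            z + η * ℕ→ℚ (length L)        ≡⟨ load≡ ⟨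
            load u 0≤u x y ∎
            where
            cancel : ∀ z → 1ℚ - (- (z - 1ℚ)) ≡ z + 0ℚ
            cancel = solve 1 (λ z → con 1ℚ :- (:- (z :- con 1ℚ)) := z :+ con 0ℚ) refl

          upper : load u 0≤u x y ≤ (1ℚ + η) + η * M
          upper = begin
            load u 0≤u x y                    ≡⟨ load≡ ⟩
            z + η * ℕ→ℚ (length L)            ≡⟨ cong (_+ η * ℕ→ℚ (length L)) (cancel z) ⟩
            (1ℚ + (z - 1ℚ)) + η * ℕ→ℚ (length L)
              ≤⟨ ℚ.+-mono-≤ (ℚ.+-monoʳ-≤ 1ℚ (∣p∣≤q⇒p≤q ∣z-1∣≤η))
                   (*-monoˡ (ℚ.<⇒≤ 0<η) (ℕ→ℚ-mono {length L} {m} (List.length-filter _ (subsets n)))) ⟩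
            (1ℚ + η) + η * M ∎
            where
            cancel : ∀ z → z ≡ 1ℚ + (z - 1ℚ)
            cancel = solve 1 (λ z → z := con 1ℚ :+ (z :- con 1ℚ)) refl

open Duality

-- The join of regular bipartite graphs: degrees, divisibility, obstruction

module Construction where

  open import Data.Nat.Base using (_+_; _*_; _≤_; _<_)

  -- Exchanging the exceptional value l for k makes the family constant. The k stands on the left so
  -- that nothing is subtracted.
  ∑-one-off : ∀ {n k l} {f : Fin n → ℕ} j → f j ≡ l → (∀ {i} → i ≢ j → f i ≡ k) → sum f + k ≡ n * k + l
  ∑-one-off {n} {k} {l} {f} j fj f≢j = begin
    sum f + k                                      ≡⟨ cong (sum f +_) (∑-delta (λ _ → k) j) ⟨
    sum f + ∑[ i < n ] (⟦ i Fin.≟ j ⟧ * k)         ≡⟨ ∑-distrib-+ f (λ i → ⟦ i Fin.≟ j ⟧ * k) ⟨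
    ∑[ i < n ] (f i + ⟦ i Fin.≟ j ⟧ * k)           ≡⟨ sum-cong-≗ term ⟩
    ∑[ i < n ] (k + ⟦ i Fin.≟ j ⟧ * l)             ≡⟨ ∑-distrib-+ (λ _ → k) (λ i → ⟦ i Fin.≟ j ⟧ * l) ⟩
    ∑[ i < n ] k + ∑[ i < n ] (⟦ i Fin.≟ j ⟧ * l)  ≡⟨ cong₂ _+_ (∑-const n k) (∑-delta (λ _ → l) j) ⟩
    n * k + l ∎
    where
    open ≡-Reasoning
    term : ∀ i → f i + ⟦ i Fin.≟ j ⟧ * k ≡ k + ⟦ i Fin.≟ j ⟧ * l
    term i with i Fin.≟ j
    ... | yes refl = trans (cong (_+ (k + 0)) fj)
      (trans (ℕ.+-comm l (k + 0)) (cong₂ _+_ (ℕ.+-identityʳ k) (sym (ℕ.+-identityʳ l))))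
    ... | no i≢j   = cong (_+ 0) (f≢j i≢j)

  ∑-snoc : ∀ n (h : ℕ → ℕ) → ∑[ u < suc n ] h (toℕ u) ≡ ∑[ u < n ] h (toℕ u) + h n
  ∑-snoc zero    h = ℕ.+-identityʳ (h 0)
  ∑-snoc (suc n) h = trans (cong (h 0 +_) (∑-snoc n (h ∘ suc))) (sym (ℕ.+-assoc (h 0) _ _))

  ∑-⟦<⟧ : ∀ {P D} → D ≤ P → ∑[ u < P ] ⟦ toℕ u ℕ.<? D ⟧ ≡ D
  ∑-⟦<⟧ {zero}          z≤n       = refl
  ∑-⟦<⟧ {suc P} {zero}  z≤n       = trans (∑-const (suc P) 0) (ℕ.*-zeroʳ (suc P))
  ∑-⟦<⟧ {suc P} {suc D} (s≤s D≤P) = cong suc (∑-⟦<⟧ D≤P)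

  -- Induction on the shift: passing from t to t + 1 drops the term for u = 0 and appends the one
  -- for u = P, and these agree modulo P.
  ∑-⟦%<⟧ : ∀ {P D} .{{_ : NonZero P}} → D ≤ P → ∀ t → ∑[ u < P ] ⟦ (t + toℕ u) % P ℕ.<? D ⟧ ≡ D
  ∑-⟦%<⟧ {P} {D} D≤P zero = trans
    (sum-cong-≗ {P} (λ u → cong (λ m → ⟦ m ℕ.<? D ⟧) (m<n⇒m%n≡m (Fin.toℕ<n u)))) (∑-⟦<⟧ D≤P)
  ∑-⟦%<⟧ {P} {D} D≤P (suc t) = trans (ℕ.+-cancelʳ-≡ (h 0) _ _ rotate) (∑-⟦%<⟧ D≤P t)
    where
    open ≡-Reasoning
    h : ℕ → ℕ
    h u = ⟦ (t + u) % P ℕ.<? D ⟧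
    rotate : ∑[ u < P ] ⟦ (suc t + toℕ u) % P ℕ.<? D ⟧ + h 0 ≡ ∑[ u < P ] h (toℕ u) + h 0
    rotate = begin
      ∑[ u < P ] ⟦ (suc t + toℕ u) % P ℕ.<? D ⟧ + h 0
        ≡⟨ cong (_+ h 0) (sum-cong-≗ {P} (λ u → cong (λ m → ⟦ m % P ℕ.<? D ⟧) (sym (ℕ.+-suc t (toℕ u))))) ⟩
      ∑[ u < P ] h (suc (toℕ u)) + h 0    ≡⟨ ℕ.+-comm _ (h 0) ⟩
      ∑[ u < suc P ] h (toℕ u)            ≡⟨ ∑-snoc P h ⟩
      ∑[ u < P ] h (toℕ u) + h P
        ≡⟨ cong (λ m → ∑[ u < P ] h (toℕ u) + ⟦ m ℕ.<? D ⟧)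
             (trans ([m+n]%n≡m%n t P) (cong (_% P) (sym (ℕ.+-identityʳ t)))) ⟩
      ∑[ u < P ] h (toℕ u) + h 0 ∎

  module Join (s′ P D : ℕ) .{{_ : NonZero P}} (D≤P : D ≤ P) where

    s N : ℕ
    s = suc s′
    N = 2 * P

    Point : Set
    Point = Fin s × Fin 2 × Fin P

    point : Fin (s * N) → Point
    point x = proj₁ (remQuot {s} N x) , remQuot {2} P (proj₂ (remQuot {s} N x))

    point-combine : ∀ a i t → point (combine a (combine i t)) ≡ (a , i , t)
    point-combine a i t = trans
      (cong (λ z → proj₁ z , remQuot {2} P (proj₂ z)) (Fin.remQuot-combine a (combine i t)))
      (cong (a ,_) (Fin.remQuot-combine i t))

    part : Fin (s * N) → Fin s
    part = proj₁ ∘ point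

    ∑-point : (f : Point → ℕ) → ∑[ x < s * N ] f (point x) ≡ ∑[ a < s ] ∑[ i < 2 ] ∑[ t < P ] f (a , i , t)
    ∑-point f = trans (∑-combine s {N} (f ∘ point)) (sum-cong-≗ {s} (λ a →
      trans (∑-combine 2 {P} (λ r → f (point (combine a r))))
        (∑-cong₂ {2} {P} {λ i t → f (point (combine a (combine i t)))} {λ i t → f (a , i , t)}
          (λ i t → cong f (point-combine a i t)))))

    -- A circulant bipartite graph: two copies of the residues modulo P, with t and u joined when t
    -- + u falls into a window of length D. Using the sum instead of the difference makes the
    -- relation symmetric in the two sides. `Close` does not look at the part, because between
    -- different parts `Near` holds anyway.
    Close Near : Point → Point → Set
    Close (_ , i , t) (_ , j , u) = i ≢ j × (toℕ t + toℕ u) % P < D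
    Near x y = proj₁ x ≢ proj₁ y ⊎ Close x y

    close? : ∀ x y → Dec (Close x y)
    close? (_ , i , t) (_ , j , u) = ¬? (i Fin.≟ j) ×-dec ((toℕ t + toℕ u) % P ℕ.<? D)

    near? : ∀ x y → Dec (Near x y)
    near? x y = ¬? (proj₁ x Fin.≟ proj₁ y) ⊎-dec close? x y

    near-sym : ∀ {x y} → Near x y → Near y x
    near-sym (inj₁ a≢b) = inj₁ (a≢b ∘ sym)
    near-sym {_ , _ , t} {_ , _ , u} (inj₂ (i≢j , tu<D)) =
      inj₂ (i≢j ∘ sym , subst (λ m → m % P < D) (ℕ.+-comm (toℕ t) (toℕ u)) tu<D)

    near-irrefl : ∀ {x y} → x ≡ y → ¬ Near x y
    near-irrefl refl (inj₁ a≢a)       = a≢a refl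
    near-irrefl refl (inj₂ (i≢i , _)) = i≢i refl

    graph : Graph
    graph = record
      { v      = s * N
      ; Adj    = λ x y → Near (point x) (point y)
      ; adj?   = λ x y → near? (point x) (point y)
      ; symm   = λ {x} {y} → near-sym {point x} {point y}
      ; irrefl = λ x≡y → near-irrefl (cong point x≡y)
      }

    ∑-close : ∀ x b → ∑[ j < 2 ] ∑[ u < P ] ⟦ close? x (b , j , u) ⟧ ≡ D
    ∑-close x@(a , i , t) b = ℕ.+-cancelʳ-≡ D _ _ (trans
      (∑-one-off {2} {D} {0} {λ j → ∑[ u < P ] ⟦ close? x (b , j , u) ⟧} i
        (trans (∑-const′ {P} {0} (λ u → ⟦⟧-no (close? x (b , i , u)) (λ (i≢i , _) → i≢i refl))) (ℕ.*-zeroʳ P))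
        (λ {j} j≢i → trans (sum-cong-≗ {P} (λ u →
                             ⟦⟧-cong (close? x (b , j , u)) ((toℕ t + toℕ u) % P ℕ.<? D) proj₂ (λ tu<D → j≢i ∘ sym , tu<D)))
                           (∑-⟦%<⟧ D≤P (toℕ t))))
      (double D))
      where
      double : ∀ D → 2 * D + 0 ≡ D + D
      double = solve-∀

    ∑-near : ∀ x → ∑[ b < s ] ∑[ j < 2 ] ∑[ u < P ] ⟦ near? x (b , j , u) ⟧ ≡ s′ * N + D
    ∑-near x@(a , i , t) = ℕ.+-cancelʳ-≡ N _ _ (trans
      (∑-one-off {s} {N} {D} {λ b → ∑[ j < 2 ] ∑[ u < P ] ⟦ near? x (b , j , u) ⟧} a
        (trans (∑-cong₂ {2} {P} {g = λ j u → ⟦ close? x (a , j , u) ⟧} (λ j u →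
                 ⟦⟧-cong (near? x (a , j , u)) (close? x (a , j , u))
                 (λ { (inj₁ a≢a) → contradiction refl a≢a ; (inj₂ close) → close }) inj₂))
               (∑-close x a))
        (λ {b} b≢a → ∑-const′ {2} {P} (λ j → trans
          (∑-const′ {P} {1} (λ u → ⟦⟧-yes (near? x (b , j , u)) (inj₁ (b≢a ∘ sym)))) (ℕ.*-identityʳ P))))
      (regroup s′ N D))
      where
      regroup : ∀ s′ N D → suc s′ * N + D ≡ s′ * N + D + N
      regroup = solve-∀

    degree : ∀ x → d graph x ≡ s′ * N + D
    degree x = trans (d≡∑ graph x) (trans (∑-point (λ y → ⟦ near? (point x) y ⟧)) (∑-near (point x)))

    ∑-inner : ∀ x → ∑[ y < s * N ] inner graph part x y ≡ D
    ∑-inner x = trans (∑-point (λ y → ⟦ near? (point x) y ⟧ * ⟦ part x Fin.≟ proj₁ y ⟧))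
      (ℕ.+-cancelʳ-≡ 0 _ _ (trans
      (∑-one-off {s} {0} {D} {f} (part x) same-part other-part)
      (swap s D)))
      where
      f : Fin s → ℕ
      f b = ∑[ j < 2 ] ∑[ u < P ] (⟦ near? (point x) (b , j , u) ⟧ * ⟦ part x Fin.≟ b ⟧)

      same-part : f (part x) ≡ D
      same-part = trans (∑-cong₂ {2} {P} {g = λ j u → ⟦ close? (point x) (part x , j , u) ⟧} (λ j u → trans
        (cong₂ _*_ (⟦⟧-cong (near? (point x) (part x , j , u)) (close? (point x) (part x , j , u))
                      (λ { (inj₁ a≢a) → contradiction refl a≢a ; (inj₂ close) → close }) inj₂)
                   (⟦⟧-yes (part x Fin.≟ part x) refl))
        (ℕ.*-identityʳ ⟦ close? (point x) (part x , j , u) ⟧))) (∑-close (point x) (part x))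

      other-part : ∀ {b} → b ≢ part x → f b ≡ 0
      other-part {b} b≢ = ∑-const′ {2} {0} (λ j → trans (∑-const′ {P} {0} (λ u →
        trans (cong (⟦ near? (point x) (b , j , u) ⟧ *_) (⟦⟧-no (part x Fin.≟ b) (b≢ ∘ sym)))
              (ℕ.*-zeroʳ ⟦ near? (point x) (b , j , u) ⟧)))
        (ℕ.*-zeroʳ P))

      swap : ∀ s D → s * 0 + D ≡ D + 0
      swap = solve-∀

    -- Required because `δ` takes its minimum with the default value `v`.
    degree≤v : s′ * N + D ≤ s * N
    degree≤v = ℕ.≤-trans (ℕ.+-monoʳ-≤ (s′ * N) (ℕ.≤-trans D≤P (ℕ.m≤m+n P (P + 0)))) (ℕ.≤-reflexive (ℕ.+-comm (s′ * N) N))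

    minimum-degree : s′ * N + D ≤ δ graph
    minimum-degree = v≤min⁺ degree≤v
      (All.map⁺ (All.tabulate⁺ (λ x → ℕ.≤-reflexive (sym (degree x)))))

    edge-count : e graph ≡ s * P * (s′ * N + D)
    edge-count = ℕ.*-cancelˡ-≡ _ _ 2 (begin
      2 * e graph                   ≡⟨ handshake graph ⟩
      ∑[ x < s * N ] d graph x      ≡⟨ ∑-const′ {s * N} degree ⟩
      s * N * (s′ * N + D)          ≡⟨ regroup s P (s′ * N + D) ⟩
      2 * (s * P * (s′ * N + D)) ∎)
      where
      open ≡-Reasoning
      regroup : ∀ s P m → s * (2 * P) * m ≡ 2 * (s * P * m)
      regroup = solve-∀

    -- The weightings compared are 2 g on all adjacent pairs and q (q - 1) on inner ones, where g =
    -- q - s. A copy has q (q - 1) ordered adjacent pairs, at least 2 g of them inner, so it never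
    -- favours the first; the hypothesis says that the whole graph does.
    no-fractional-decomposition : ∀ g → let q₁ = g + s′ in
      suc q₁ * q₁ * (s * N * D) < 2 * g * (s * N * (s′ * N + D)) → ¬ FractionalDecomposition (suc q₁) graph
    no-fractional-decomposition g total = no-fractional q graph
      (λ x y → 2 * g * ⟦ adj? graph x y ⟧) (λ x y → q * q₁ * inner graph part x y)
      (λ {x} {y} x≁y → trans (cong (2 * g *_) (⟦⟧-no (adj? graph x y) x≁y)) (ℕ.*-zeroʳ (2 * g)))
      (λ {x} {y} x≁y → trans (cong (λ m → q * q₁ * (m * same graph part x y)) (⟦⟧-no (adj? graph x y) x≁y)) (ℕ.*-zeroʳ (q * q₁)))
      on-copies
      (subst₂ _<_ (sym (totals (q * q₁) (inner graph part) ∑-inner))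
                  (sym (totals (2 * g) (λ x y → ⟦ adj? graph x y ⟧) (λ x → trans (sym (d≡∑ graph x)) (degree x)))) total)
      where
      q₁ = g + s′
      q = suc q₁
      n = s * N

      totals : ∀ k (h : Fin n → Fin n → ℕ) {m} → (∀ x → sum (h x) ≡ m) → ∑[ x < n ] ∑[ y < n ] (k * h x y) ≡ k * (n * m)
      totals k h rows = trans (sym (*-distribˡ-∑₂ k h)) (cong (k *_) (∑-const′ {n} rows))

      within-* : ∀ S k (h : Fin n → Fin n → ℕ) → within graph S (λ x y → k * h x y) ≡ k * within graph S h
      within-* S k h = trans (∑-cong₂ {n} {n} (λ x y → swap (⟦ x ∈? S ⟧ * ⟦ y ∈? S ⟧) k (h x y)))
                             (sym (*-distribˡ-∑₂ k (λ x y → ⟦ x ∈? S ⟧ * ⟦ y ∈? S ⟧ * h x y)))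
        where
        swap : ∀ a k h → a * (k * h) ≡ k * (a * h)
        swap = solve-∀

      on-copies : ∀ {S} → IsCopy q graph S →
        within graph S (λ x y → 2 * g * ⟦ adj? graph x y ⟧) ≤ within graph S (λ x y → q * q₁ * inner graph part x y)
      on-copies {S} copy = begin
        within graph S (λ x y → 2 * g * ⟦ adj? graph x y ⟧)      ≡⟨ within-* S (2 * g) (λ x y → ⟦ adj? graph x y ⟧) ⟩
        2 * g * within graph S (λ x y → ⟦ adj? graph x y ⟧)      ≡⟨ cong (2 * g *_) adj≡ ⟩
        2 * g * (q * q₁)                                         ≡⟨ ℕ.*-comm (2 * g) (q * q₁) ⟩
        q * q₁ * (2 * g)                                         ≤⟨ ℕ.*-monoʳ-≤ (q * q₁) 2g≤ ⟩
        q * q₁ * within graph S (inner graph part)               ≡⟨ within-* S (q * q₁) (inner graph part) ⟨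
        within graph S (λ x y → q * q₁ * inner graph part x y) ∎
        where
        open ℕ.≤-Reasoning
        square : ∀ q₁ → suc q₁ * suc q₁ ≡ suc q₁ * q₁ + suc q₁
        square = solve-∀
        adj≡ : within graph S (λ x y → ⟦ adj? graph x y ⟧) ≡ q * q₁
        adj≡ = ℕ.+-cancelʳ-≡ q _ _ (trans (within-adj graph copy) (square q₁))
        double : ∀ g s′ → 2 * suc (g + s′) ≡ 2 * g + 2 * suc s′
        double = solve-∀
        2g≤ : 2 * g ≤ within graph S (inner graph part)
        2g≤ = ℕ.+-cancelʳ-≤ (2 * s) _ _ (ℕ.≤-trans (ℕ.≤-reflexive (sym (double g s′))) (within-inner graph part copy))

  2*nC2 : ∀ n → 2 * (suc n C 2) ≡ suc n * n
  2*nC2 zero    = refl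
  2*nC2 (suc n) = begin
    2 * (suc (suc n) C 2)               ≡⟨ cong (2 *_) (nCk+nC[k+1]≡[n+1]C[k+1] (suc n) 1) ⟨
    2 * (suc n C 1 + suc n C 2)         ≡⟨ ℕ.*-distribˡ-+ 2 (suc n C 1) (suc n C 2) ⟩
    2 * (suc n C 1) + 2 * (suc n C 2)   ≡⟨ cong₂ _+_ (cong (2 *_) (nC1≡n (suc n))) (2*nC2 n) ⟩
    2 * suc n + suc n * n               ≡⟨ expand n ⟩
    suc (suc n) * suc n ∎
    where
    open ≡-Reasoning
    expand : ∀ n → 2 * suc n + suc n * n ≡ suc (suc n) * suc n
    expand = solve-∀

  4mn≤[m+n]² : ∀ m n → 4 * (m * n) ≤ (m + n) * (m + n)
  4mn≤[m+n]² m n with ℕ.≤-total m n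
  ... | inj₁ m≤n with ℕ.m≤n⇒∃[o]m+o≡n m≤n
  ...   | k , refl = subst (4 * (m * (m + k)) ≤_) (sym (expand m k)) (ℕ.m≤m+n _ _)
    where
    expand : ∀ m k → (m + (m + k)) * (m + (m + k)) ≡ 4 * (m * (m + k)) + k * k
    expand = solve-∀
  4mn≤[m+n]² m n | inj₂ n≤m with ℕ.m≤n⇒∃[o]m+o≡n n≤m
  ...   | k , refl = subst (4 * ((n + k) * n) ≤_) (sym (expand n k)) (ℕ.m≤m+n _ _)
    where
    expand : ∀ n k → ((n + k) + n) * ((n + k) + n) ≡ 4 * ((n + k) * n) + k * k
    expand = solve-∀

  -- Here s = suc s′ parts and g = q − s; parts have 2 P vertices, and equality in
  -- q (q − 1) D = 2 g · degree would need D / 2 P slightly above the value 2 g s′ / q² used here.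
  module Family (g s′ : ℕ) .{{_ : NonZero g}} .{{_ : NonZero s′}} where

    q₁ q s : ℕ
    q₁ = g + s′
    q  = suc q₁
    s  = suc s′

    instance
      q₁-nonZero : NonZero q₁
      q₁-nonZero = >-nonZero (ℕ.≤-trans (>-nonZero⁻¹ g) (ℕ.m≤m+n g s′))

    -- The factor q - 1 in `T` makes the degrees divisible and, together with q² in `P`, makes the
    -- edge count a multiple of q (q - 1). The factor i + 1 separates the members of the family by
    -- their orders.
    T P D : ℕ → ℕ
    T i = q₁ * suc i
    P i = q * q * T i
    D i = 4 * (g * s′) * T i

    instance
      T-nonZero : ∀ {i} → NonZero (T i)
      T-nonZero {i} = ℕ.m*n≢0 q₁ (suc i)
      P-nonZero : ∀ {i} → NonZero (P i)
      P-nonZero {i} = ℕ.m*n≢0 (q * q) (T i)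

    -- 4 g s′ ≤ (g + s′)² = (q - 1)², so sides of size `P` have room for a `D`-regular bipartite
    -- graph.
    D≤P : ∀ i → D i ≤ P i
    D≤P i = ℕ.*-monoˡ-≤ (T i) (ℕ.≤-trans (4mn≤[m+n]² g s′) (ℕ.*-mono-≤ (ℕ.n≤1+n q₁) (ℕ.n≤1+n q₁)))

    module _ (i : ℕ) where
      open Join s′ (P i) (D i) (D≤P i) public using (graph; degree; edge-count; minimum-degree; no-fractional-decomposition)

    Δ : ℕ → ℕ
    Δ i = s′ * (2 * P i) + D i

    T∣D : ∀ i → T i ∣ D i
    T∣D i = n∣m*n (4 * (g * s′))

    T∣Δ : ∀ i → T i ∣ Δ i
    T∣Δ i = ∣m∣n⇒∣m+n (∣n⇒∣m*n s′ (∣n⇒∣m*n 2 (n∣m*n (q * q)))) (T∣D i)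

    divisible : ∀ i → Divisible q (graph i)
    divisible i = record
      { edges   = subst (q C 2 ∣_) (sym (edge-count i))
          (∣m⇒∣m*n (Δ i) (∣n⇒∣m*n s (divides (2 * (q * suc i))
            (trans (regroup q q₁ (suc i)) (trans (cong (λ m → q * suc i * m) (sym (2*nC2 q₁))) (regroup′ (q * suc i) (q C 2)))))))
      ; degrees = λ x → subst (q₁ ∣_) (sym (degree i x)) (∣-trans (∣m⇒∣m*n (suc i) (divides 1 (sym (ℕ.*-identityˡ q₁)))) (T∣Δ i))
      }
      where
      regroup : ∀ q q₁ k → q * q * (q₁ * k) ≡ q * k * (q * q₁)
      regroup = solve-∀
      regroup′ : ∀ m b → m * (2 * b) ≡ 2 * m * b
      regroup′ = solve-∀

    not-fractional : ∀ i → ¬ FractionalDecomposition q (graph i)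
    not-fractional i = no-fractional-decomposition i g (begin-strict
      q * q₁ * (n * D i)                 ≡⟨ left q q₁ n (g * s′) (T i) ⟩
      -- Both totals are multiples of `K`; what remains is q (q - 1) < q² + 2 g.
      K * (q * q₁)                       <⟨ ℕ.*-monoʳ-< K (ℕ.*-monoʳ-< q (ℕ.n<1+n q₁)) ⟩
      K * (q * q)                        ≤⟨ ℕ.*-monoʳ-≤ K (ℕ.m≤m+n (q * q) (2 * g)) ⟩
      K * (q * q + 2 * g)                ≡⟨ right g q s′ n (T i) ⟨
      2 * g * (n * Δ i) ∎)
      where
      open ℕ.≤-Reasoning
      n = s * (2 * P i)
      K = n * (4 * (g * s′) * T i)
      instance
        K-nonZero : NonZero K
        K-nonZero = ℕ.m*n≢0 n (4 * (g * s′) * T i)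
          {{ℕ.m*n≢0 s (2 * P i) {{_}} {{ℕ.m*n≢0 2 (P i)}}}}
          {{ℕ.m*n≢0 (4 * (g * s′)) (T i) {{ℕ.m*n≢0 4 (g * s′) {{_}} {{ℕ.m*n≢0 g s′}}}}}}
      left : ∀ q q₁ n a T → q * q₁ * (n * (4 * a * T)) ≡ n * (4 * a * T) * (q * q₁)
      left = solve-∀
      right : ∀ g q s′ n T → 2 * g * (n * (s′ * (2 * (q * q * T)) + 4 * (g * s′) * T)) ≡ n * (4 * (g * s′) * T) * (q * q + 2 * g)
      right = solve-∀

    distinct : ∀ {i j} → i ≢ j → ¬ (graph i ≅ graph j)
    distinct {i} {j} i≢j (f , _) = i≢j (ℕ.suc-injective (ℕ.*-cancelˡ-≡ (suc i) (suc j) q₁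
      (ℕ.*-cancelˡ-≡ (T i) (T j) (q * q) (ℕ.*-cancelˡ-≡ (P i) (P j) 2 (ℕ.*-cancelˡ-≡ (2 * P i) (2 * P j) s (↔⇒≡ f))))))

open Construction

-- The choice of the number of parts and the minimum degree estimate

module MinimumDegree where

  open import Data.Rational.Base using (_+_; _-_; _*_; -_; _≤_; _<_)
  open +-*-Solver using (solve; con; _:+_; _:*_; _:-_; :-_; _:=_)

  *-mono-≤₀ : ∀ {p q r s} → 0ℚ ≤ p → 0ℚ ≤ s → p ≤ q → r ≤ s → p * r ≤ q * s
  *-mono-≤₀ 0≤p 0≤s p≤q r≤s = ℚ.≤-trans (*-monoˡ 0≤p r≤s) (*-monoʳ 0≤s p≤q)

  square-cancel-≤ : ∀ {p q} → 0ℚ ≤ q → p * p ≤ q * q → p ≤ q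
  square-cancel-≤ {p} {q} 0≤q p²≤q² with p ℚ.≤? q
  ... | yes p≤q = p≤q
  ... | no p≰q  = contradiction (ℚ.<-≤-trans q²<p² p²≤q²) (ℚ.<-irrefl refl)
    where
    q<p = ℚ.≰⇒> p≰q
    q²<p² : q * q < p * p
    q²<p² = ℚ.≤-<-trans (*-monoˡ 0≤q (ℚ.<⇒≤ q<p))
      (ℚ.*-monoˡ-<-pos p {{positive (ℚ.≤-<-trans 0≤q q<p)}} q<p)

  -- With s = `s₀` + 2, the two bounds pin down s without mentioning √2. The successors record g ≥ 1
  -- and s ≥ 2, so that g and s - 1 are nonzero, as `Family` requires.
  record Parameters (q : ℕ) : Set where
    constructor parameters
    field
      g₀ s₀ : ℕ
      q≡    : q ≡ suc (suc g₀ ℕ.+ suc s₀)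
      lower : 2 ℕ.* (suc (suc s₀) ℕ.* suc (suc s₀)) ℕ.≤ q ℕ.* q
      upper : q ℕ.* q ℕ.< 2 ℕ.* (suc (suc (suc s₀)) ℕ.* suc (suc (suc s₀)))

  -- The optimal number of parts is s = ⌊q/√2⌋.
  choose : ∀ q → 4 ℕ.≤ q → Parameters q
  choose q 4≤q = go (isqrt h) (ℕ.≤-trans (ℕ.*-monoʳ-≤ 2 (isqrt-lower h)) 2h≤q²)
      (ℕ.<-≤-trans q²<2[1+h] (ℕ.*-monoʳ-≤ 2 (isqrt-upper h)))
    where
    open ℕ.≤-Reasoning
    h = (q ℕ.* q) / 2

    2h≤q² : 2 ℕ.* h ℕ.≤ q ℕ.* q
    2h≤q² = ℕ.≤-trans (ℕ.≤-reflexive (ℕ.*-comm 2 h)) (m/n*n≤m (q ℕ.* q) 2)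

    q²<2[1+h] : q ℕ.* q ℕ.< 2 ℕ.* suc h
    q²<2[1+h] = begin-strict
      q ℕ.* q                                ≡⟨ m≡m%n+[m/n]*n (q ℕ.* q) 2 ⟩
      (q ℕ.* q) % 2 ℕ.+ h ℕ.* 2              <⟨ ℕ.+-monoˡ-< (h ℕ.* 2) (m%n<n (q ℕ.* q) 2) ⟩
      suc h ℕ.* 2                            ≡⟨ ℕ.*-comm (suc h) 2 ⟩
      2 ℕ.* suc h ∎

    16≤q² : 16 ℕ.≤ q ℕ.* q
    16≤q² = ℕ.*-mono-≤ 4≤q 4≤q

    go : ∀ s → 2 ℕ.* (s ℕ.* s) ℕ.≤ q ℕ.* q → q ℕ.* q ℕ.< 2 ℕ.* (suc s ℕ.* suc s) → Parameters q
    -- For s ≤ 1 the upper bound would give q² < 8, against q ≥ 4.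
    go 0 _ upper = contradiction (ℕ.≤-trans upper (ℕ.m≤m+n 2 14)) (ℕ.≤⇒≯ 16≤q²)
    go 1 _ upper = contradiction (ℕ.≤-trans upper (ℕ.m≤m+n 8 8)) (ℕ.≤⇒≯ 16≤q²)
    go s@(suc (suc s₀)) lower upper = from-gap (ℕ.m≤n⇒∃[o]m+o≡n s<q)
      where
      s<q : s ℕ.< q
      s<q = ℕ.≰⇒> (λ q≤s → ℕ.<⇒≱ (ℕ.<-≤-trans (ℕ.m<m+n (s ℕ.* s) {s ℕ.* s ℕ.+ 0} (s≤s z≤n)) lower) (ℕ.*-mono-≤ q≤s q≤s))
      from-gap : (∃ λ g₀ → suc s ℕ.+ g₀ ≡ q) → Parameters q
      from-gap (g₀ , eq) = parameters g₀ s₀ (trans (sym eq) (shuffle s₀ g₀)) lower upper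
        where
        shuffle : ∀ s₀ g₀ → suc (suc (suc s₀)) ℕ.+ g₀ ≡ suc (suc g₀ ℕ.+ suc s₀)
        shuffle = solve-∀

  -- 2 T · M is the number of non-neighbours of a vertex, itself included.
  module _ (g₀ s₀ : ℕ) where

    private
      g s q M : ℕ
      g = suc g₀
      s = suc (suc s₀)
      q = suc (g ℕ.+ suc s₀)
      M = g ℕ.* g ℕ.+ s ℕ.* s ℕ.+ 2 ℕ.* g

    -- After adding s² on both sides and substituting q = g + s, this is exactly 2 s² ≤ q². It
    -- trades `M` for a multiple of g, to which `root-bound` applies.
    co-degree-upper : 2 ℕ.* (s ℕ.* s) ℕ.≤ q ℕ.* q → M ℕ.≤ 2 ℕ.* (suc q ℕ.* g)
    co-degree-upper lower = ℕ.+-cancelʳ-≤ (s ℕ.* s) _ _ (begin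
      M ℕ.+ s ℕ.* s                                    ≡⟨ left g s ⟩
      g ℕ.* g ℕ.+ 2 ℕ.* g ℕ.+ 2 ℕ.* (s ℕ.* s)          ≤⟨ ℕ.+-monoʳ-≤ (g ℕ.* g ℕ.+ 2 ℕ.* g) lower ⟩
      g ℕ.* g ℕ.+ 2 ℕ.* g ℕ.+ q ℕ.* q                  ≡⟨ right g (suc s₀) ⟩
      2 ℕ.* (suc q ℕ.* g) ℕ.+ s ℕ.* s ∎)
      where
      open ℕ.≤-Reasoning
      left : ∀ g s → g ℕ.* g ℕ.+ s ℕ.* s ℕ.+ 2 ℕ.* g ℕ.+ s ℕ.* s ≡ g ℕ.* g ℕ.+ 2 ℕ.* g ℕ.+ 2 ℕ.* (s ℕ.* s)
      left = solve-∀
      right : ∀ g s′ → g ℕ.* g ℕ.+ 2 ℕ.* g ℕ.+ suc (g ℕ.+ s′) ℕ.* suc (g ℕ.+ s′)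
        ≡ 2 ℕ.* (suc (suc (g ℕ.+ s′)) ℕ.* g) ℕ.+ suc s′ ℕ.* suc s′
      right = solve-∀

    -- (g + s)² ≤ 2 (g² + s²). This makes ε (q + 1) `M` large enough to absorb the error 19 q².
    co-degree-lower : q ℕ.* q ℕ.≤ 2 ℕ.* M
    co-degree-lower = ℕ.+-cancelʳ-≤ (4 ℕ.* (g ℕ.* s)) _ _ (begin
      q ℕ.* q ℕ.+ 4 ℕ.* (g ℕ.* s)                        ≤⟨ ℕ.+-monoʳ-≤ (q ℕ.* q) (4mn≤[m+n]² g s) ⟩
      q ℕ.* q ℕ.+ (g ℕ.+ s) ℕ.* (g ℕ.+ s)                ≤⟨ ℕ.m≤m+n _ (4 ℕ.* g) ⟩
      q ℕ.* q ℕ.+ (g ℕ.+ s) ℕ.* (g ℕ.+ s) ℕ.+ 4 ℕ.* g    ≡⟨ expand g (suc s₀) ⟩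
      2 ℕ.* M ℕ.+ 4 ℕ.* (g ℕ.* s) ∎)
      where
      open ℕ.≤-Reasoning
      expand : ∀ g s′ → suc (g ℕ.+ s′) ℕ.* suc (g ℕ.+ s′) ℕ.+ (g ℕ.+ suc s′) ℕ.* (g ℕ.+ suc s′) ℕ.+ 4 ℕ.* g
        ≡ 2 ℕ.* (g ℕ.* g ℕ.+ suc s′ ℕ.* suc s′ ℕ.+ 2 ℕ.* g) ℕ.+ 4 ℕ.* (g ℕ.* suc s′)
      expand = solve-∀

    -- As s < q, the excess 4 q² + (2 q + 1)(s + 4) over s q² is at most 6 q² + 9 q + 4, hence at
    -- most 19 q².
    error-bound : suc q ℕ.* suc q ℕ.* (s ℕ.+ 4) ℕ.≤ s ℕ.* (q ℕ.* q) ℕ.+ 19 ℕ.* (q ℕ.* q)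
    error-bound = subst (λ q → suc q ℕ.* suc q ℕ.* (s ℕ.+ 4) ℕ.≤ s ℕ.* (q ℕ.* q) ℕ.+ 19 ℕ.* (q ℕ.* q))
      (cong suc (ℕ.+-suc g₀ (suc s₀)))
      (ℕ.≤-trans (ℕ.m≤m+n _ _) (ℕ.≤-reflexive (sym (expand g₀ s))))
      where
      expand : ∀ g₀ s →
        s ℕ.* (suc (g₀ ℕ.+ s) ℕ.* suc (g₀ ℕ.+ s)) ℕ.+ 19 ℕ.* (suc (g₀ ℕ.+ s) ℕ.* suc (g₀ ℕ.+ s))
        ≡ suc (suc (g₀ ℕ.+ s)) ℕ.* suc (suc (g₀ ℕ.+ s)) ℕ.* (s ℕ.+ 4)
          ℕ.+ (2 ℕ.* (suc (g₀ ℕ.+ s) ℕ.* suc g₀) ℕ.+ suc g₀ ℕ.+ 9 ℕ.* (suc (g₀ ℕ.+ s) ℕ.* (g₀ ℕ.+ s))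
            ℕ.+ 4 ℕ.* ((g₀ ℕ.+ s) ℕ.* (g₀ ℕ.+ s) ℕ.+ 2 ℕ.* (g₀ ℕ.+ s)))
      expand = solve-∀

    module _ {τ : ℚ} (0≤τ : 0ℚ ≤ τ) (τ²≤2 : τ * τ ≤ ℕ→ℚ 2) where

      τ≤2 : τ ≤ ℕ→ℚ 2
      τ≤2 = square-cancel-≤ (0≤ℕ→ℚ 2) (ℚ.≤-trans τ²≤2
        (ℚ.≤-trans (ℕ→ℚ-mono {2} {2 ℕ.* 2} (ℕ.m≤m+n 2 2)) (ℚ.≤-reflexive (ℕ→ℚ-* 2 2))))

      -- If s were exactly q/√2, then (1 + √2)(q - s) = s. In general put B = s + 1 - g₀; then q = 2
      -- g₀ + B, and q² < 2 (s + 1)² yields 2 g₀² ≤ B², so τ g₀ ≤ B and (1 + τ) g₀ ≤ s + 1. Passing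
      -- from g₀ to g = g₀ + 1 costs 1 + τ ≤ 3.
      root-bound : q ℕ.* q ℕ.< 2 ℕ.* (suc s ℕ.* suc s) → (1ℚ + τ) * ℕ→ℚ g ≤ ℕ→ℚ (s ℕ.+ 4)
      root-bound upper = from-split (ℕ.m≤n⇒∃[o]m+o≡n g₀≤1+s)
        where
        open ℚ.≤-Reasoning
        q<2[1+s] : q ℕ.< 2 ℕ.* suc s
        q<2[1+s] = ℕ.≰⇒> (λ h → ℕ.<⇒≱ (ℕ.<-≤-trans upper (ℕ.≤-trans
          (ℕ.*-monoʳ-≤ 2 (ℕ.m≤m+n (suc s ℕ.* suc s) (suc s ℕ.* suc s))) (ℕ.≤-reflexive (four (suc s))))) (ℕ.*-mono-≤ h h))
          where
          four : ∀ S → 2 ℕ.* (S ℕ.* S ℕ.+ S ℕ.* S) ≡ 2 ℕ.* S ℕ.* (2 ℕ.* S)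
          four = solve-∀

        g₀≤1+s : g₀ ℕ.≤ suc s
        g₀≤1+s = ℕ.+-cancelʳ-≤ (suc s) _ _ (ℕ.≤-trans (ℕ.≤-reflexive (shuffle g₀ s₀))
          (ℕ.≤-trans (ℕ.<⇒≤ q<2[1+s]) (ℕ.≤-reflexive (cong (suc s ℕ.+_) (ℕ.+-identityʳ (suc s))))))
          where
          shuffle : ∀ g₀ s₀ → g₀ ℕ.+ suc (suc (suc s₀)) ≡ suc (suc g₀ ℕ.+ suc s₀)
          shuffle = solve-∀

        from-split : (∃ λ B → g₀ ℕ.+ B ≡ suc s) → (1ℚ + τ) * ℕ→ℚ g ≤ ℕ→ℚ (s ℕ.+ 4)
        from-split (B , g₀+B≡) = begin
          (1ℚ + τ) * ℕ→ℚ g                       ≡⟨ cong ((1ℚ + τ) *_) (ℕ→ℚ-suc g₀) ⟩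
          (1ℚ + τ) * (1ℚ + ℕ→ℚ g₀)               ≡⟨ expand τ (ℕ→ℚ g₀) ⟩
          ℕ→ℚ g₀ + τ * ℕ→ℚ g₀ + (1ℚ + τ)         ≤⟨ ℚ.+-mono-≤ (ℚ.+-monoʳ-≤ (ℕ→ℚ g₀) τg₀≤B) (ℚ.+-monoʳ-≤ 1ℚ τ≤2) ⟩
          ℕ→ℚ g₀ + ℕ→ℚ B + (1ℚ + ℕ→ℚ 2)          ≡⟨ cong₂ _+_ (sym (ℕ→ℚ-+ g₀ B)) (sym (ℕ→ℚ-suc 2)) ⟩
          ℕ→ℚ (g₀ ℕ.+ B) + ℕ→ℚ 3                 ≡⟨ ℕ→ℚ-+ (g₀ ℕ.+ B) 3 ⟨
          ℕ→ℚ (g₀ ℕ.+ B ℕ.+ 3)                   ≡⟨ cong ℕ→ℚ (trans (cong (ℕ._+ 3) g₀+B≡) (sym (ℕ.+-suc s 3))) ⟩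
          ℕ→ℚ (s ℕ.+ 4) ∎
          where
          expand : ∀ τ x → (1ℚ + τ) * (1ℚ + x) ≡ x + τ * x + (1ℚ + τ)
          expand = solve 2 (λ τ x → (con 1ℚ :+ τ) :* (con 1ℚ :+ x) := x :+ τ :* x :+ (con 1ℚ :+ τ)) refl

          q≡ : q ≡ g₀ ℕ.+ (g₀ ℕ.+ B)
          q≡ = trans (shuffle g₀ s₀) (cong (g₀ ℕ.+_) (sym g₀+B≡))
            where
            shuffle : ∀ g₀ s₀ → suc (suc g₀ ℕ.+ suc s₀) ≡ g₀ ℕ.+ suc (suc (suc s₀))
            shuffle = solve-∀

          2g₀²≤B² : 2 ℕ.* (g₀ ℕ.* g₀) ℕ.≤ B ℕ.* B
          2g₀²≤B² = ℕ.+-cancelˡ-≤ (2 ℕ.* (g₀ ℕ.* g₀) ℕ.+ 4 ℕ.* (g₀ ℕ.* B) ℕ.+ B ℕ.* B) _ _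
            (subst₂ ℕ._≤_ (trans (cong (λ m → m ℕ.* m) q≡) (left g₀ B))
                          (trans (cong (λ m → 2 ℕ.* (m ℕ.* m)) (sym g₀+B≡)) (right g₀ B)) (ℕ.<⇒≤ upper))
            where
            left : ∀ a B → (a ℕ.+ (a ℕ.+ B)) ℕ.* (a ℕ.+ (a ℕ.+ B))
              ≡ 2 ℕ.* (a ℕ.* a) ℕ.+ 4 ℕ.* (a ℕ.* B) ℕ.+ B ℕ.* B ℕ.+ 2 ℕ.* (a ℕ.* a)
            left = solve-∀
            right : ∀ a B → 2 ℕ.* ((a ℕ.+ B) ℕ.* (a ℕ.+ B))
              ≡ 2 ℕ.* (a ℕ.* a) ℕ.+ 4 ℕ.* (a ℕ.* B) ℕ.+ B ℕ.* B ℕ.+ B ℕ.* B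
            right = solve-∀

          τg₀≤B : τ * ℕ→ℚ g₀ ≤ ℕ→ℚ B
          τg₀≤B = square-cancel-≤ (0≤ℕ→ℚ B) (begin
            τ * ℕ→ℚ g₀ * (τ * ℕ→ℚ g₀)          ≡⟨ swap τ (ℕ→ℚ g₀) ⟩
            τ * τ * (ℕ→ℚ g₀ * ℕ→ℚ g₀)          ≡⟨ cong (τ * τ *_) (ℕ→ℚ-* g₀ g₀) ⟨
            τ * τ * ℕ→ℚ (g₀ ℕ.* g₀)            ≤⟨ *-monoʳ (0≤ℕ→ℚ (g₀ ℕ.* g₀)) τ²≤2 ⟩
            ℕ→ℚ 2 * ℕ→ℚ (g₀ ℕ.* g₀)            ≡⟨ ℕ→ℚ-* 2 (g₀ ℕ.* g₀) ⟨
            ℕ→ℚ (2 ℕ.* (g₀ ℕ.* g₀))            ≤⟨ ℕ→ℚ-mono {2 ℕ.* (g₀ ℕ.* g₀)} {B ℕ.* B} 2g₀²≤B² ⟩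
            ℕ→ℚ (B ℕ.* B)                      ≡⟨ ℕ→ℚ-* B B ⟩
            ℕ→ℚ B * ℕ→ℚ B ∎)
            where
            swap : ∀ τ x → τ * x * (τ * x) ≡ τ * τ * (x * x)
            swap = solve 2 (λ τ x → τ :* x :* (τ :* x) := τ :* τ :* (x :* x)) refl

      -- (c − ε)(q + 1) M exceeds s q² by at most 19 q² − ε (q + 1) M, and 2 M ≥ q².
      density-bound : 2 ℕ.* (s ℕ.* s) ℕ.≤ q ℕ.* q → q ℕ.* q ℕ.< 2 ℕ.* (suc s ℕ.* suc s) →
        ∀ {ε} → ℕ→ℚ 38 ≤ ε * ℕ→ℚ (suc q) →
        ((1ℚ + τ) * ½ - ε) * ℕ→ℚ (suc q) * ℕ→ℚ M ≤ ℕ→ℚ (s ℕ.* (q ℕ.* q))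
      density-bound lower upper {ε} 38≤εQ = begin
        ((1ℚ + τ) * ½ - ε) * Q * ℕ→ℚ M                 ≡⟨ distribute ((1ℚ + τ) * ½) ε Q (ℕ→ℚ M) ⟩
        (1ℚ + τ) * ½ * Q * ℕ→ℚ M - ε * Q * ℕ→ℚ M       ≤⟨ ℚ.+-mono-≤ main (ℚ.neg-antimono-≤ error) ⟩
        ℕ→ℚ (a ℕ.+ b) - ℕ→ℚ b                          ≡⟨ cong (_- ℕ→ℚ b) (ℕ→ℚ-+ a b) ⟩
        ℕ→ℚ a + ℕ→ℚ b - ℕ→ℚ b                          ≡⟨ cancel (ℕ→ℚ a) (ℕ→ℚ b) ⟩
        ℕ→ℚ a ∎
        where
        open ℚ.≤-Reasoning
        Q = ℕ→ℚ (suc q)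
        a = s ℕ.* (q ℕ.* q)
        b = 19 ℕ.* (q ℕ.* q)

        distribute : ∀ x ε Q M → (x - ε) * Q * M ≡ x * Q * M - ε * Q * M
        distribute = solve 4 (λ x ε Q M → (x :- ε) :* Q :* M := x :* Q :* M :- ε :* Q :* M) refl
        cancel : ∀ a b → a + b - b ≡ a
        cancel = solve 2 (λ a b → a :+ b :- b := a) refl

        0≤x : 0ℚ ≤ (1ℚ + τ) * ½
        0≤x = ℚ.≤-trans (ℚ.≤-reflexive (sym (ℚ.*-zeroˡ ½)))
          (*-monoʳ (ℚ.nonNegative⁻¹ ½) (+-nonneg (ℚ.nonNegative⁻¹ 1ℚ) 0≤τ))

        0≤xQ : 0ℚ ≤ (1ℚ + τ) * ½ * Q
        0≤xQ = ℚ.≤-trans (ℚ.≤-reflexive (sym (ℚ.*-zeroˡ Q))) (*-monoʳ (0≤ℕ→ℚ (suc q)) 0≤x)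

        main : (1ℚ + τ) * ½ * Q * ℕ→ℚ M ≤ ℕ→ℚ (a ℕ.+ b)
        main = begin
          (1ℚ + τ) * ½ * Q * ℕ→ℚ M
            ≤⟨ *-monoˡ 0≤xQ (ℕ→ℚ-mono {M} {2 ℕ.* (suc q ℕ.* g)} (co-degree-upper lower)) ⟩
          (1ℚ + τ) * ½ * Q * ℕ→ℚ (2 ℕ.* (suc q ℕ.* g))
            ≡⟨ cong ((1ℚ + τ) * ½ * Q *_) (trans (ℕ→ℚ-* 2 (suc q ℕ.* g)) (cong (ℕ→ℚ 2 *_) (ℕ→ℚ-* (suc q) g))) ⟩
          (1ℚ + τ) * ½ * Q * (ℕ→ℚ 2 * (Q * ℕ→ℚ g))           ≡⟨ halve τ Q (ℕ→ℚ g) ⟩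
          Q * Q * ((1ℚ + τ) * ℕ→ℚ g)                         ≡⟨ cong (_* ((1ℚ + τ) * ℕ→ℚ g)) (ℕ→ℚ-* (suc q) (suc q)) ⟨
          ℕ→ℚ (suc q ℕ.* suc q) * ((1ℚ + τ) * ℕ→ℚ g)         ≤⟨ *-monoˡ (0≤ℕ→ℚ (suc q ℕ.* suc q)) (root-bound upper) ⟩
          ℕ→ℚ (suc q ℕ.* suc q) * ℕ→ℚ (s ℕ.+ 4)              ≡⟨ ℕ→ℚ-* (suc q ℕ.* suc q) (s ℕ.+ 4) ⟨
          ℕ→ℚ (suc q ℕ.* suc q ℕ.* (s ℕ.+ 4))                ≤⟨ ℕ→ℚ-mono {suc q ℕ.* suc q ℕ.* (s ℕ.+ 4)} {a ℕ.+ b} error-bound ⟩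
          ℕ→ℚ (a ℕ.+ b) ∎
          where
          halve : ∀ τ Q γ → (1ℚ + τ) * ½ * Q * (ℕ→ℚ 2 * (Q * γ)) ≡ Q * Q * ((1ℚ + τ) * γ)
          halve = solve 3 (λ τ Q γ → (con 1ℚ :+ τ) :* con ½ :* Q :* (con (ℕ→ℚ 2) :* (Q :* γ))
            := Q :* Q :* ((con 1ℚ :+ τ) :* γ)) refl

        error : ℕ→ℚ b ≤ ε * Q * ℕ→ℚ M
        error = begin
          ℕ→ℚ b
            ≤⟨ ℕ→ℚ-mono {b} {38 ℕ.* M} (ℕ.≤-trans (ℕ.*-monoʳ-≤ 19 co-degree-lower) (ℕ.≤-reflexive (sym (ℕ.*-assoc 19 2 M)))) ⟩
          ℕ→ℚ (38 ℕ.* M)       ≡⟨ ℕ→ℚ-* 38 M ⟩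
          ℕ→ℚ 38 * ℕ→ℚ M       ≤⟨ *-monoʳ (0≤ℕ→ℚ M) 38≤εQ ⟩
          ε * Q * ℕ→ℚ M ∎

  *-positive : ∀ {p r} → 0ℚ < p → 0ℚ < r → 0ℚ < p * r
  *-positive {p} {r} 0<p 0<r = ℚ.positive⁻¹ (p * r) {{ℚ.pos*pos⇒pos p {{positive 0<p}} r {{positive 0<r}}}}

  0<ℕ→ℚ-suc : ∀ n → 0ℚ < ℕ→ℚ (suc n)
  0<ℕ→ℚ-suc n = ℚ.<-≤-trans (ℚ.positive⁻¹ 1ℚ) (ℕ→ℚ-mono {1} {suc n} (s≤s z≤n))

  positive-gap : ∀ {x e y} → 0ℚ < e → x + e ≤ y → 0ℚ < y - x
  positive-gap {x} {e} {y} 0<e h = ℚ.<-≤-trans 0<e (begin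
    e            ≡⟨ cancel x e ⟩
    x + e - x    ≤⟨ ℚ.+-monoˡ-≤ (- x) h ⟩
    y - x ∎)
    where
    open ℚ.≤-Reasoning
    cancel : ∀ x e → e ≡ x + e - x
    cancel = solve 2 (λ x e → e := x :+ e :- x) refl

  -- Dividing w m ≤ n by w bounds the number m of non-neighbours by n / w. The slack η gives the
  -- conclusion the form demanded by `≤ℝ`.
  min-degree-bound : ∀ {w η n m Δ δ} → 0ℚ < w → w * ℕ→ℚ m ≤ ℕ→ℚ n → Δ ℕ.+ m ≡ n → Δ ℕ.≤ δ → 0ℚ ≤ η →
    (1ℚ - recipℚ w) * ℕ→ℚ n ≤ ℕ→ℚ δ + η
  min-degree-bound {w} {η} {n} {m} {Δ} {δ} 0<w wm≤n Δ+m≡n Δ≤δ 0≤η = begin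
    (1ℚ - r) * ℕ→ℚ n                     ≡⟨ distribute r (ℕ→ℚ n) ⟩
    ℕ→ℚ n - r * ℕ→ℚ n                    ≤⟨ ℚ.+-monoʳ-≤ (ℕ→ℚ n) (ℚ.neg-antimono-≤ m≤rn) ⟩
    ℕ→ℚ n - ℕ→ℚ m                        ≡⟨ cong (_- ℕ→ℚ m) (trans (cong ℕ→ℚ (sym Δ+m≡n)) (ℕ→ℚ-+ Δ m)) ⟩
    ℕ→ℚ Δ + ℕ→ℚ m - ℕ→ℚ m                ≡⟨ cancel (ℕ→ℚ Δ) (ℕ→ℚ m) ⟩
    ℕ→ℚ Δ + 0ℚ                           ≤⟨ ℚ.+-mono-≤ (ℕ→ℚ-mono {Δ} {δ} Δ≤δ) 0≤η ⟩
    ℕ→ℚ δ + η ∎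
    where
    open ℚ.≤-Reasoning
    r = recipℚ w
    distribute : ∀ r n → (1ℚ - r) * n ≡ n - r * n
    distribute = solve 2 (λ r n → (con 1ℚ :- r) :* n := n :- r :* n) refl
    cancel : ∀ a b → a + b - b ≡ a + 0ℚ
    cancel = solve 2 (λ a b → a :+ b :- b := a :+ con 0ℚ) refl
    m≤rn : ℕ→ℚ m ≤ r * ℕ→ℚ n
    m≤rn = begin
      ℕ→ℚ m              ≡⟨ ℚ.*-identityˡ (ℕ→ℚ m) ⟨
      1ℚ * ℕ→ℚ m         ≡⟨ cong (_* ℕ→ℚ m) (trans (ℚ.*-comm r w) (p*recip≡1 0<w)) ⟨
      r * w * ℕ→ℚ m      ≡⟨ ℚ.*-assoc r w (ℕ→ℚ m) ⟩
      r * (w * ℕ→ℚ m)    ≤⟨ *-monoˡ (ℚ.<⇒≤ (recip-pos 0<w)) wm≤n ⟩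
      r * ℕ→ℚ n ∎

  -- It suffices that 1 / (N + 1) ≤ ε₀ and q ≥ 38 (N + 1). The 38 is 2 · 19, from `error-bound` and
  -- q² ≤ 2 M; the summand 4 serves `choose`.
  threshold : ∀ {ε₀} → 0ℚ < ε₀ → ∃ λ q₀ → 4 ℕ.≤ q₀ × (∀ {q} → q₀ ℕ.≤ q → ℕ→ℚ 38 ≤ ε₀ * ℕ→ℚ (suc q))
  threshold {ε₀} 0<ε₀ = 4 ℕ.+ 38 ℕ.* suc N , ℕ.m≤m+n 4 (38 ℕ.* suc N) , λ {q} q₀≤q → begin
    ℕ→ℚ 38                                 ≡⟨ ℚ.*-identityʳ (ℕ→ℚ 38) ⟨
    ℕ→ℚ 38 * 1ℚ                            ≡⟨ cong (ℕ→ℚ 38 *_) (suc*unit N) ⟨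
    ℕ→ℚ 38 * (ℕ→ℚ (suc N) * unit N)        ≡⟨ ℚ.*-assoc (ℕ→ℚ 38) (ℕ→ℚ (suc N)) (unit N) ⟨
    ℕ→ℚ 38 * ℕ→ℚ (suc N) * unit N          ≡⟨ cong (_* unit N) (ℕ→ℚ-* 38 (suc N)) ⟨
    ℕ→ℚ (38 ℕ.* suc N) * unit N            ≡⟨ ℚ.*-comm (ℕ→ℚ (38 ℕ.* suc N)) (unit N) ⟩
    unit N * ℕ→ℚ (38 ℕ.* suc N)            ≤⟨ *-mono-≤₀ (0≤unit N) (0≤ℕ→ℚ (suc q)) (proj₂ (archimedean 0<ε₀))
                                                (ℕ→ℚ-mono {38 ℕ.* suc N} {suc q}
                                                  (ℕ.m≤n⇒m≤1+n (ℕ.≤-trans (ℕ.m≤n+m (38 ℕ.* suc N) 4) q₀≤q))) ⟩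
    ε₀ * ℕ→ℚ (suc q) ∎
    where
    open ℚ.≤-Reasoning
    N = proj₁ (archimedean 0<ε₀)

  Counterexample : (ε : ℝ) → ε <ℝ c → ℕ → Graph → Set₁
  Counterexample ε ε<c q G = Divisible q G
    × (1ℝ -ℝ ((c -ℝ ε) *ℝ fromℕ (suc q)) ⁻¹⟨ 0<*ℝ {c -ℝ ε} {fromℕ (suc q)} (<ℝ⇒0<- {ε} {c} ε<c) (0<fromℕ-suc q) ⟩) *ℝ fromℕ (v G)
        ≤ℝ fromℕ (δ G)
    × ¬ Decomposition q G
    × ¬ FractionalDecomposition q G

  module _ (ε : ℝ) (0<ε : 0ℝ <ℝ ε) (ε<c : ε <ℝ c) where

    private
      -- A positive rational that the terms of `ε` eventually dominate; the threshold for q depends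
      -- on it alone.
      ε₀ = proj₁ 0<ε

    counterexamples : ∀ q → Parameters q → ℕ→ℚ 38 ≤ ε₀ * ℕ→ℚ (suc q) → InfinitelyMany (Counterexample ε ε<c q)
    counterexamples q (parameters g₀ s₀ refl lower upper) 38≤ε₀Q =
      graph
      , (λ i → divisible i , min-degree i , (λ D → decomposition⇒¬¬fractional q (graph i) D (not-fractional i)) , not-fractional i)
      , distinct
      where
      open Family (suc g₀) (suc s₀) using (graph; divisible; not-fractional; distinct; T; P; Δ; minimum-degree)
      g = suc g₀
      s = suc (suc s₀)
      M = g ℕ.* g ℕ.+ s ℕ.* s ℕ.+ 2 ℕ.* g

      co-degree : ∀ i → Δ i ℕ.+ 2 ℕ.* T i ℕ.* M ≡ v (graph i)
      co-degree i = expand g (suc s₀) (T i)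
        where
        expand : ∀ g s′ T → s′ ℕ.* (2 ℕ.* (suc (g ℕ.+ s′) ℕ.* suc (g ℕ.+ s′) ℕ.* T)) ℕ.+ 4 ℕ.* (g ℕ.* s′) ℕ.* T
            ℕ.+ 2 ℕ.* T ℕ.* (g ℕ.* g ℕ.+ suc s′ ℕ.* suc s′ ℕ.+ 2 ℕ.* g)
          ≡ suc s′ ℕ.* (2 ℕ.* (suc (g ℕ.+ s′) ℕ.* suc (g ℕ.+ s′) ℕ.* T))
        expand = solve-∀

      scaled : ∀ i {w} → w * ℕ→ℚ M ≤ ℕ→ℚ (s ℕ.* (q ℕ.* q)) → w * ℕ→ℚ (2 ℕ.* T i ℕ.* M) ≤ ℕ→ℚ (v (graph i))
      scaled i {w} wM≤ = begin
        w * ℕ→ℚ (2 ℕ.* T i ℕ.* M)                   ≡⟨ cong (w *_) (ℕ→ℚ-* (2 ℕ.* T i) M) ⟩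
        w * (ℕ→ℚ (2 ℕ.* T i) * ℕ→ℚ M)               ≡⟨ swap w (ℕ→ℚ (2 ℕ.* T i)) (ℕ→ℚ M) ⟩
        ℕ→ℚ (2 ℕ.* T i) * (w * ℕ→ℚ M)               ≤⟨ *-monoˡ (0≤ℕ→ℚ (2 ℕ.* T i)) wM≤ ⟩
        ℕ→ℚ (2 ℕ.* T i) * ℕ→ℚ (s ℕ.* (q ℕ.* q))     ≡⟨ ℕ→ℚ-* (2 ℕ.* T i) (s ℕ.* (q ℕ.* q)) ⟨
        ℕ→ℚ (2 ℕ.* T i ℕ.* (s ℕ.* (q ℕ.* q)))       ≡⟨ cong ℕ→ℚ (regroup s q (T i)) ⟩
        ℕ→ℚ (v (graph i)) ∎
        where
        open ℚ.≤-Reasoning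
        swap : ∀ w t m → w * (t * m) ≡ t * (w * m)
        swap = solve 3 (λ w t m → w :* (t :* m) := t :* (w :* m)) refl
        regroup : ∀ s q T → 2 ℕ.* T ℕ.* (s ℕ.* (q ℕ.* q)) ≡ s ℕ.* (2 ℕ.* (q ℕ.* q ℕ.* T))
        regroup = solve-∀

      -- The real inequality read at one index: operations on reals act termwise, and τ and ε′ stand
      -- for the terms of √2 and of `ε`. The positive gap keeps the reciprocal away from its default
      -- value 0.
      min-degree-approx : ∀ i {τ ε′ η} → 0ℚ ≤ τ → τ * τ ≤ ℕ→ℚ 2 → ε₀ ≤ ε′ → 0ℚ < (1ℚ + τ) * ½ - ε′ → 0ℚ < η →
        (1ℚ - recipℚ (((1ℚ + τ) * ½ - ε′) * ℕ→ℚ (suc q))) * ℕ→ℚ (v (graph i)) ≤ ℕ→ℚ (δ (graph i)) + η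
      min-degree-approx i {τ} {ε′} {η} 0≤τ τ²≤2 ε₀≤ε′ gap 0<η = min-degree-bound
        {w} {η} {v (graph i)} {2 ℕ.* T i ℕ.* M} {Δ i} {δ (graph i)}
        (*-positive {(1ℚ + τ) * ½ - ε′} {ℕ→ℚ (suc q)} gap (0<ℕ→ℚ-suc q))
        (scaled i {w} (density-bound g₀ s₀ 0≤τ τ²≤2 lower upper {ε′}
          (ℚ.≤-trans 38≤ε₀Q (*-monoʳ {ε₀} {ε′} (0≤ℕ→ℚ (suc q)) ε₀≤ε′))))
        (co-degree i) (minimum-degree i) (ℚ.<⇒≤ 0<η)
        where
        w = ((1ℚ + τ) * ½ - ε′) * ℕ→ℚ (suc q)

      min-degree : ∀ i → (1ℝ -ℝ ((c -ℝ ε) *ℝ fromℕ (suc q))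
          ⁻¹⟨ 0<*ℝ {c -ℝ ε} {fromℕ (suc q)} (<ℝ⇒0<- {ε} {c} ε<c) (0<fromℕ-suc q) ⟩) *ℝ fromℕ (v (graph i))
        ≤ℝ fromℕ (δ (graph i))
      min-degree i η 0<η = proj₁ both , λ k K≤k →
        -- The terms of √2 approach it from below, so τ² ≤ 2 holds at every index; only ε₀ ≤ ε′ and
        -- the gap to `c` require k to be large.
        min-degree-approx i {√-seq 2 k} {seq ε k} (√-seq-nonneg 2 k) (√-seq-lower 2 k)
          (subst (_≤ seq ε k) (ℚ.+-identityˡ ε₀) (proj₁ (proj₂ both k K≤k)))
          (positive-gap (proj₁ (proj₂ ε<c)) (proj₂ (proj₂ both k K≤k))) 0<η
        where
        both = Eventually-× (proj₂ (proj₂ 0<ε)) (proj₂ (proj₂ ε<c))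

open MinimumDegree

open import Data.Nat.Base using (_≤_)

theorem1p4 : (ε : ℝ) → 0ℝ <ℝ ε → (ε<c : ε <ℝ c) →
    ∃ λ (q₀ : ℕ) → ∀ (q : ℕ) → q₀ ≤ q →
    InfinitelyMany λ G →
    Divisible q G
    × (1ℝ -ℝ ((c -ℝ ε) *ℝ fromℕ (suc q)) ⁻¹⟨ 0<*ℝ {c -ℝ ε} {fromℕ (suc q)} (<ℝ⇒0<- {ε} {c} ε<c) (0<fromℕ-suc q) ⟩) *ℝ fromℕ (v G)
    ≤ℝ fromℕ (δ G)
    × ¬ Decomposition q G
    × ¬ FractionalDecomposition q G
theorem1p4 ε 0<ε ε<c = proj₁ t , λ q q₀≤q →
  counterexamples ε 0<ε ε<c q (choose q (ℕ.≤-trans (proj₁ (proj₂ t)) q₀≤q)) (proj₂ (proj₂ t) q₀≤q)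
  where
  t = threshold (proj₁ (proj₂ 0<ε))
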